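{- For every $n\ge 0$ and each of the ten pairs $(\tau,\mathsf{stat})$ listed below, $$C_n(t,q)=\sum_{\pi\in\mathfrak{S}_n(\tau)}t^{\mathsf{des}\,\pi}q^{\mathsf{stat}\,\pi}.$$ The ten pairs are: (1) $(231,\ 13\text{ - }2)$; (2) $(231,\ \mathsf{adi}^*)$; (3) $(312,\ 2\text{ - }13)$; (4) $(312,\ \mathsf{adi})$; (5) $(213,\ 31\text{ - }2)$; (6) $(132,\ 2\text{ - }31)$; (7) $(231,\ 31\text{ - }2)$; (8) $(312,\ 2\text{ - }31)$; (9) $(213,\ 13\text{ - }2)$; (10) $(132,\ 2\text{ - }13)$.
   Context: The $(q,t)$-Catalan numbers $C_n(t,q)$ are defined as the Taylor coefficients of the continued fraction $$\sum_{n\ge0}C_n(t,q)z^n=\cfrac{1}{1-\cfrac{c_1z}{1-\cfrac{c_2z}{1-\cfrac{c_3z}{\ddots}}}},\qquad c_{2k-1}=q^{k-1},\ c_{2k}=tq^{k-1}\ (k\ge1).$$ $\mathfrak{S}_n$ is the set of permutations of $[n]$; $\mathfrak{S}_n(\tau)$ is the set of $\pi\in\mathfrak{S}_n$ avoiding the classical pattern $\tau$ (no subsequence order-isomorphic to $\tau$). $\mathsf{des}\,\pi=\#\{i\in[n-1]:\pi(i)>\pi(i+1)\}$. Vincular pattern counts: $(31\text{ - }2)\pi=\#\{(i,j): i+1<j\le n,\ \pi(i+1)<\pi(j)<\pi(i)\}$; $(2\text{ - }31)\pi=\#\{(i,j): j<i<n,\ \pi(i+1)<\pi(j)<\pi(i)\}$;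 $(2\text{ - }13)\pi=\#\{(i,j): j<i<n,\ \pi(i)<\pi(j)<\pi(i+1)\}$; $(13\text{ - }2)\pi=\#\{(i,j): i+1<j\le n,\ \pi(i)<\pi(j)<\pi(i+1)\}$. Admissible inversions: set $\pi(n+1)=0$; an inversion pair $(\pi(i),\pi(j))$ (i.e. $1\le i<j\le n$, $\pi(i)>\pi(j)$) is admissible if $\pi(j)<\pi(j+1)$ or there is $l$ with $i<l<j$ and $\pi(l)<\pi(j)$; $\mathsf{adi}\,\pi$ is the number of admissible inversions. Star admissible inversions: set $\pi(0)=n+1$; an inversion pair $(\pi(i),\pi(j))$ with $i<j$ is star admissible if $\pi(i-1)<\pi(i)$ or there is $l$ with $i<l<j$ and $\pi(l)>\pi(i)$; $\mathsf{adi}^*\,\pi$ is their number. -}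

module Defs where

open import Algebra.Bundles using (CommutativeRing)
open import Data.Bool.Base using (if_then_else_)
open import Data.Fin.Base as Fin using (Fin; zero; suc; toℕ; fromℕ<)
import Data.Fin.Properties as Fin
open import Data.Fin.Patterns using (0F; 1F; 2F)
open import Data.List.Base as List using (List; []; _∷_; length; filter; map; upTo; allFin; cartesianProduct; cartesianProductWith)
open import Data.List.Membership.Propositional using (_∈_; lose; find)
open import Data.List.Membership.Propositional.Properties using (∈-cartesianProductWith⁺; ∈-allFin; ∈-filter⁺; ∈-filter⁻)
open import Data.List.Relation.Unary.All using ([]; _∷_)
open import Data.List.Relation.Unary.Any using (here; any?)
open import Data.List.Relation.Unary.AllPairs using ([]; _∷_)
open import Data.List.Relation.Unary.Unique.Propositional using (Unique)
import Data.List.Relation.Unary.Unique.Propositional.Properties as Unique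
open import Data.Nat.Base using (ℕ; zero; suc; _∸_; _<_; _≤_; pred; _≡ᵇ_)
open import Data.Nat.DivMod using (_/_; _%_; m*n%n≡0; m*n/n≡m; [m+kn]%n≡m%n; +-distrib-/-∣ʳ)
open import Data.Nat.Divisibility using (divides)
import Data.Nat.Base as ℕ
open import Data.Nat.Properties using (_<?_; anyUpTo?; ≤-trans; n≤1+n; ≤-refl; ≤-pred)
open import Data.Product.Base using (_×_; _,_; proj₁; proj₂; ∃)
open import Data.Vec.Base using (Vec; []; _∷_; lookup)
open import Data.Vec.Properties using (∷-injective)
import Data.Vec.Functional as Vector
open import Function.Base using (_∘_)
open import Function.Bundles using (_⇔_; mk⇔)
open import Function.Definitions using (Bijective)
open import Level using (Level)
open import Relation.Binary.PropositionalEquality.Core as ≡ using (_≡_; refl)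
open import Relation.Nullary.Decidable using (Dec; yes; no; _×-dec_; _⊎-dec_; _→-dec_; ¬?; map′)
open import Relation.Nullary.Negation using (¬_)

-- A permutation of [n] is given by its one-line notation, a word with letters in
-- Fin n; positions and letters are both shifted down by one.

Word : ℕ → ℕ → Set
Word k n = Vec (Fin n) k

words : ∀ k n → List (Word k n)
words zero    n = [] ∷ []
words (suc k) n = cartesianProductWith _∷_ (allFin n) (words k n)

∈-words : ∀ {k n} (w : Word k n) → w ∈ words k n
∈-words []      = here refl
∈-words (x ∷ w) = ∈-cartesianProductWith⁺ _∷_ (∈-allFin x) (∈-words w)

words-unique : ∀ k n → Unique (words k n)
words-unique zero    n = [] ∷ []
words-unique (suc k) n = Unique.cartesianProductWith⁺ _∷_ ∷-injective (Unique.allFin⁺ n) (words-unique k n)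

IsPermutation : ∀ {n} → Word n n → Set
IsPermutation π = Bijective _≡_ _≡_ (lookup π)

isPermutation? : ∀ {n} (π : Word n n) → Dec (IsPermutation π)
isPermutation? π = injective? ×-dec surjective?
  where
  injective? = map′ (λ f {x} {y} → f x y) (λ f x y → f {x} {y})
    (Fin.all? λ x → Fin.all? λ y → (lookup π x Fin.≟ lookup π y) →-dec (x Fin.≟ y))
  surjective? = map′ (λ f y → proj₁ (f y) , λ { refl → proj₂ (f y) }) (λ f y → proj₁ (f y) , proj₂ (f y) refl)
    (Fin.all? λ y → Fin.any? λ x → lookup π x Fin.≟ y)

-- ι lists the positions of a subsequence of π that is order-isomorphic to τ.
Occurrence : ∀ {k n} → Word k k → Word n n → Word k n → Set
Occurrence τ π ι =
  (∀ a b → a Fin.< b → lookup ι a Fin.< lookup ι b) ×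
  (∀ a b → (lookup τ a Fin.< lookup τ b → lookup π (lookup ι a) Fin.< lookup π (lookup ι b)) ×
           (lookup π (lookup ι a) Fin.< lookup π (lookup ι b) → lookup τ a Fin.< lookup τ b))

Contains Avoids : ∀ {k n} → Word k k → Word n n → Set
Contains τ π = ∃ λ ι → Occurrence τ π ι
Avoids   τ π = ¬ Contains τ π

occurrence? : ∀ {k n} (τ : Word k k) (π : Word n n) (ι : Word k n) → Dec (Occurrence τ π ι)
occurrence? τ π ι =
  (Fin.all? λ a → Fin.all? λ b → (a Fin.<? b) →-dec (lookup ι a Fin.<? lookup ι b)) ×-dec
  (Fin.all? λ a → Fin.all? λ b →
    ((lookup τ a Fin.<? lookup τ b) →-dec (lookup π (lookup ι a) Fin.<? lookup π (lookup ι b))) ×-dec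
    ((lookup π (lookup ι a) Fin.<? lookup π (lookup ι b)) →-dec (lookup τ a Fin.<? lookup τ b)))

avoids? : ∀ {k n} (τ : Word k k) (π : Word n n) → Dec (Avoids τ π)
avoids? {k} {n} τ π = ¬? (map′ (λ p → let (ι , _ , o) = find p in ι , o) (λ (ι , o) → lose (∈-words ι) o)
  (any? (occurrence? τ π) (words k n)))

𝔖 : ∀ {k} n → Word k k → List (Word n n)
𝔖 n τ = filter (λ π → isPermutation? π ×-dec avoids? τ π) (words n n)

∈-𝔖 : ∀ {k n} (τ : Word k k) (π : Word n n) → π ∈ 𝔖 n τ ⇔ (IsPermutation π × Avoids τ π)
∈-𝔖 {n = n} τ π = mk⇔ (proj₂ ∘ ∈-filter⁻ P? {xs = words n n}) (∈-filter⁺ P? (∈-words π))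
  where P? = λ ρ → isPermutation? ρ ×-dec avoids? τ ρ

𝔖-unique : ∀ {k} n (τ : Word k k) → Unique (𝔖 n τ)
𝔖-unique n τ = Unique.filter⁺ _ (words-unique n n)

p132 p213 p231 p312 : Word 3 3
p132 = 0F ∷ 2F ∷ 1F ∷ []
p213 = 1F ∷ 0F ∷ 2F ∷ []
p231 = 1F ∷ 2F ∷ 0F ∷ []
p312 = 2F ∷ 0F ∷ 1F ∷ []

-- π ⟨ i ⟩ is the 1-based value π(i) ∈ {1,…,n} for 1 ≤ i ≤ n, extended by the
-- boundary conventions π(0) = n+1 (used only by adi*) and π(n+1) = 0 (used only by adi).
infix 9 _⟨_⟩
_⟨_⟩ : ∀ {n} → Word n n → ℕ → ℕ
_⟨_⟩ {n} π zero    = suc n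
_⟨_⟩ {n} π (suc i) with i <? n
... | yes i<n = suc (toℕ (lookup π (fromℕ< i<n)))
... | no  _   = 0

[1…_] : ℕ → List ℕ
[1… n ] = map suc (upTo n)

count : ∀ n {P : ℕ → Set} → (∀ i → Dec (P i)) → ℕ
count n P? = length (filter P? [1… n ])

countPairs : ∀ n {P : ℕ → ℕ → Set} → (∀ i j → Dec (P i j)) → ℕ
countPairs n P? = length (filter (λ (i , j) → P? i j) (cartesianProduct [1… n ] [1… n ]))

des 31-2 2-31 2-13 13-2 adi adi* : ∀ {n} → Word n n → ℕ

des {n} π = count (n ∸ 1) λ i → π ⟨ suc i ⟩ <? π ⟨ i ⟩

31-2 {n} π = countPairs n λ i j → (suc i <? j) ×-dec (π ⟨ suc i ⟩ <? π ⟨ j ⟩) ×-dec (π ⟨ j ⟩ <? π ⟨ i ⟩)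

2-31 {n} π = countPairs n λ i j → (j <? i) ×-dec (i <? n) ×-dec (π ⟨ suc i ⟩ <? π ⟨ j ⟩) ×-dec (π ⟨ j ⟩ <? π ⟨ i ⟩)

2-13 {n} π = countPairs n λ i j → (j <? i) ×-dec (i <? n) ×-dec (π ⟨ i ⟩ <? π ⟨ j ⟩) ×-dec (π ⟨ j ⟩ <? π ⟨ suc i ⟩)

13-2 {n} π = countPairs n λ i j → (suc i <? j) ×-dec (π ⟨ i ⟩ <? π ⟨ j ⟩) ×-dec (π ⟨ j ⟩ <? π ⟨ suc i ⟩)

-- anyUpTo? P? j decides ∃ l, l < j × P l.
adi {n} π = countPairs n λ i j →
  (i <? j) ×-dec (π ⟨ j ⟩ <? π ⟨ i ⟩) ×-dec
  ((π ⟨ j ⟩ <? π ⟨ suc j ⟩) ⊎-dec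
   anyUpTo? (λ l → (i <? l) ×-dec (π ⟨ l ⟩ <? π ⟨ j ⟩)) j)

adi* {n} π = countPairs n λ i j →
  (i <? j) ×-dec (π ⟨ j ⟩ <? π ⟨ i ⟩) ×-dec
  ((π ⟨ pred i ⟩ <? π ⟨ i ⟩) ⊎-dec
   anyUpTo? (λ l → (i <? l) ×-dec (π ⟨ i ⟩ <? π ⟨ l ⟩)) j)

pairs : ∀ n → List (Word 3 3 × (Word n n → ℕ))
pairs n =
  (p231 , 13-2) ∷
  (p231 , adi*) ∷
  (p312 , 2-13) ∷
  (p312 , adi)  ∷
  (p213 , 31-2) ∷
  (p132 , 2-31) ∷
  (p231 , 31-2) ∷
  (p312 , 2-31) ∷
  (p213 , 13-2) ∷
  (p132 , 2-13) ∷ []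

module PowerSeries {a ℓ : Level} (R : CommutativeRing a ℓ) where

  open CommutativeRing R hiding (zero) renaming (refl to ≈-refl)
  open import Algebra.Properties.Semiring.Sum semiring using (sum; sum-cong-≋)
  open import Relation.Binary.Reasoning.Setoid setoid

  Series : Set a
  Series = ℕ → Carrier

  infix 4 _≈ₛ_
  _≈ₛ_ : Series → Series → Set ℓ
  f ≈ₛ g = ∀ n → f n ≈ g n

  1ₛ : Series
  1ₛ zero    = 1#
  1ₛ (suc n) = 0#

  z·_ : Series → Series
  (z· f) zero    = 0#
  (z· f) (suc n) = f n

  _*ₛ_ : Series → Series → Series
  (f *ₛ g) n = sum {suc n} λ i → f (toℕ i) * g (n ∸ toℕ i)

  -- For f with constant term 1, the coefficients of g = 1/f are determined by
  -- g₀ = 1 and gₙ₊₁ = - Σ_{i≤n} fᵢ₊₁ gₙ₋ᵢ; recips f n is the vector (gₙ, …, g₀).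
  recips : Series → ∀ n → Vector.Vector Carrier (suc n)
  recips f zero    = λ _ → 1#
  recips f (suc n) = (- sum (λ i → f (suc (toℕ i)) * recips f n i)) Vector.∷ recips f n

  recip : Series → Series
  recip f n = recips f n zero

  recips-recip : ∀ f n i → recips f n i ≡ recip f (n ∸ toℕ i)
  recips-recip f zero    zero    = refl
  recips-recip f (suc n) zero    = refl
  recips-recip f (suc n) (suc i) = recips-recip f n i

  recip-inverse : ∀ f → f 0 ≈ 1# → f *ₛ recip f ≈ₛ 1ₛ
  recip-inverse f f₀ zero = trans (+-identityʳ _) (trans (*-identityʳ _) f₀)
  recip-inverse f f₀ (suc n) = begin
    f 0 * recip f (suc n) + sum {suc n} (λ i → f (suc (toℕ i)) * recip f (n ∸ toℕ i))
      ≈⟨ +-cong (trans (*-congʳ f₀) (*-identityˡ _))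
                (sum-cong-≋ {suc n} λ i → *-cong (≈-refl {f (suc (toℕ i))}) (reflexive (≡.sym (recips-recip f n i)))) ⟩
    - s + s
      ≈⟨ -‿inverseˡ s ⟩
    0# ∎
    where s = sum {suc n} (λ i → f (suc (toℕ i)) * recips f n i)

  -- The N-th convergent of  1/(1 - cₖz/(1 - cₖ₊₁z/(1 - ⋯))).
  convergent : (ℕ → Carrier) → (N k : ℕ) → Series
  convergent c zero    k = 1ₛ
  convergent c (suc N) k = recip λ n → 1ₛ n - c k * (z· convergent c N (suc k)) n

  -- The z-adic limit of the convergents of  1/(1 - c₁z/(1 - c₂z/(1 - ⋯))):
  -- the coefficient of zⁿ is constant from the n-th convergent on (convergent-stable).
  continuedFraction : (ℕ → Carrier) → Series
  continuedFraction c n = convergent c n 1 n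

  recips-cong : ∀ {f g} n → (∀ {m} → m ≤ n → f m ≈ g m) → ∀ i → recips f n i ≈ recips g n i
  recips-cong zero    f≈g i       = ≈-refl
  recips-cong (suc n) f≈g zero    = -‿cong (sum-cong-≋ {suc n} λ i →
    *-cong (f≈g (Fin.toℕ<n i)) (recips-cong n (λ m≤n → f≈g (≤-trans m≤n (n≤1+n n))) i))
  recips-cong (suc n) f≈g (suc i) = recips-cong n (λ m≤n → f≈g (≤-trans m≤n (n≤1+n n))) i

  convergents-agree : ∀ c {M N} k n → n ≤ M → n ≤ N → convergent c M k n ≈ convergent c N k n
  convergents-agree c {zero}  {zero}  k zero    _ _ = ≈-refl
  convergents-agree c {zero}  {suc N} k zero    _ _ = ≈-refl
  convergents-agree c {suc M} {zero}  k zero    _ _ = ≈-refl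
  convergents-agree c {suc M} {suc N} k n n≤M n≤N = recips-cong n tails-agree zero
    where
    tails-agree : ∀ {m} → m ≤ n → 1ₛ m - c k * (z· convergent c M (suc k)) m ≈ 1ₛ m - c k * (z· convergent c N (suc k)) m
    tails-agree {zero}  _   = ≈-refl
    tails-agree {suc m} m<n = +-congˡ (-‿cong (*-congˡ
      (convergents-agree c (suc k) m (≤-pred (≤-trans m<n n≤M)) (≤-pred (≤-trans m<n n≤N)))))

  convergent-stable : ∀ c {N} n → n ≤ N → convergent c N 1 n ≈ continuedFraction c n
  convergent-stable c n n≤N = convergents-agree c 1 n n≤N ≤-refl

module QTCatalan {a ℓ : Level} (R : CommutativeRing a ℓ) (t q : CommutativeRing.Carrier R) where

  open CommutativeRing R hiding (zero; refl)
  open import Algebra.Properties.Semiring.Exp (CommutativeRing.semiring R) using (_^_)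
  open PowerSeries R

  -- c₂ₖ₋₁ = qᵏ⁻¹ and c₂ₖ = t qᵏ⁻¹ for k ≥ 1; c₀ does not occur in the continued fraction.
  c : ℕ → Carrier
  c zero    = 0#
  c (suc i) = if i % 2 ≡ᵇ 0 then q ^ (i / 2) else t * q ^ (i / 2)

  c-odd : ∀ k → c (suc (k ℕ.* 2)) ≡ q ^ k
  c-odd k rewrite m*n%n≡0 k 2 ⦃ _ ⦄ | m*n/n≡m k 2 ⦃ _ ⦄ = refl

  c-even : ∀ k → c (suc (suc (k ℕ.* 2))) ≡ t * q ^ k
  c-even k rewrite [m+kn]%n≡m%n 1 k 2 ⦃ _ ⦄ | +-distrib-/-∣ʳ 1 {k ℕ.* 2} {2} (divides k refl) | m*n/n≡m k 2 ⦃ _ ⦄ = refl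

  C : ℕ → Carrier
  C = continuedFraction c

  Σ𝔖 : ∀ n → Word 3 3 → (Word n n → ℕ) → Carrier
  Σ𝔖 n τ stat = List.foldr _+_ 0# (map (λ π → t ^ des π * q ^ stat π) (𝔖 n τ))

{-# OPTIONS --safe #-}

-- A 231-avoiding permutation is a word a L R, where a is its first letter, L is a 231-avoiding
-- arrangement of the letters below a and R one of the letters above a; this makes it a binary
-- tree.  The contribution of L or R to the statistics depends on the rest of the word only through
-- the preceding letter, which is above all of L and below all of R.  Hence des (or asc) and
-- 13-2 (or 31-2) are computed by a recursion on trees with two states, and the generating
-- functions X, Y of the states "above" and "below" satisfy, for (des, 31-2),
--   X = 1 + t z X Y(qz),  Y = 1 + z X Y,
-- which is the functional equation of the continued fraction, and for (des, 13-2),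
--   X = 1 + t z X Y,  Y = 1 + z X(qz) Y,
-- which is solved by X = 1 + t (C - 1), C = 1 + z X Y.  For (asc, 13-2) and
-- (asc, 31-2) the same two systems arise with X and Y exchanged.  The complement takes 213 to
-- 231 and des to asc, the reverse-complement takes 312 to 231 and 132 to 213, and on
-- 231-avoiders adi* is 13-2 while on 312-avoiders adi is 2-13.

module Submission where

open import Defs
open import Algebra.Bundles using (CommutativeRing)
open import Data.Fin.Base using (zero; suc; toℕ)
open import Data.List.Base as List using (List; []; _∷_; _++_; map; cartesianProductWith)
open import Data.List.Membership.Propositional using (_∈_)
open import Data.List.Membership.Propositional.Properties using (∈-cartesianProductWith⁺; ∈-cartesianProductWith⁻; ∈-++⁺ˡ; ∈-++⁺ʳ; ∈-++⁻)
open import Data.List.Relation.Binary.Permutation.Propositional as ↭ using (_↭_)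
open import Data.List.Relation.Unary.All using (All; []; _∷_)
open import Data.List.Relation.Unary.AllPairs using ([]; _∷_)
open import Data.List.Relation.Unary.Any using (here; there)
open import Data.List.Relation.Unary.Unique.Propositional using (Unique)
import Data.List.Relation.Unary.Unique.Propositional.Properties as Unique
open import Data.Nat.Base as ℕ using (ℕ; zero; suc; _≤_; z≤n; s≤s; pred)
import Data.Nat.Properties as ℕ
open import Data.Product.Base using (_×_; _,_; ∃; ∃₂)
open import Data.Sum.Base using (_⊎_; inj₁; inj₂)
open import Function.Base using (_∘_)
open import Function.Bundles using (Equivalence)
open import Relation.Binary.PropositionalEquality.Core as ≡ using (_≡_; refl; cong; cong₂; subst)

-- Power series

-- The vincular statistics count triples, yet they split along a L R. A step inside a L is followed
-- by letters of R that exceed both of its ends, so none of them lies between; a step that starts at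
-- or after the last letter of a L sees only letters of R. Among the later letters, a step down to
-- the first letter of a factor passes over exactly its right subtree and a step up over exactly its
-- left subtree. So q marks the size of one subtree, which is the substitution of q z for z in one
-- factor of X Y. The continued fraction fits the first system because c_(k+2) = q c_k: two levels
-- down it repeats with q z for z. If D is the fraction that starts at c_2, then X = D and Y = C.
-- The second system does not come from the levels of the fraction. If its total 1 + z X Y is to be
-- C, then X = 1 + t z X Y forces X = 1 + t (C - 1), and what remains is the identity X Y = D C. It
-- holds because both sides solve one linear equation.

module SeriesAlgebra {a ℓ} (R : CommutativeRing a ℓ) where

  open CommutativeRing R hiding (zero; refl)
  open CommutativeRing R using () renaming (refl to ≈-refl)
  open import Algebra.Properties.Semiring.Exp semiring using (_^_)
  open import Algebra.Properties.CommutativeSemigroup +-commutativeSemigroup as + using ()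
  open import Algebra.Properties.CommutativeSemigroup *-commutativeSemigroup as * using ()
  open import Algebra.Properties.Ring ring using (-‿distribˡ-*; -‿distribʳ-*; -‿involutive; -0#≈0#)
  open import Algebra.Properties.Semiring.Sum semiring using (sum; sum-cong-≋)
  open import Relation.Binary.Reasoning.Setoid setoid
  open PowerSeries R

  infixr 7 _·_
  _·_ : Carrier → Series → Series
  (x · f) n = x * f n

  infixl 6 _+ₛ_
  _+ₛ_ : Series → Series → Series
  (f +ₛ g) n = f n + g n

  -- The substitution of x z for z.
  scale : Carrier → Series → Series
  scale x f n = x ^ n * f n

  tail : Series → Series
  tail f n = f (suc n)

  -- A coefficient of a product sees no later coefficients of its factors; the bounded form serves
  -- the inductions in which agreement is known only up to `n`. The proof follows the reduction of
  -- `(f *ₛ g) (suc n)` to `f 0 * g (suc n) + (tail f *ₛ g) n`, as do the product laws below.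
  *ₛ-cong-≤ : ∀ {f f′ g g′} n → (∀ m → m ≤ n → f m ≈ f′ m) → (∀ m → m ≤ n → g m ≈ g′ m) →
              (f *ₛ g) n ≈ (f′ *ₛ g′) n
  *ₛ-cong-≤ zero    p q = +-congʳ (*-cong (p 0 z≤n) (q 0 z≤n))
  *ₛ-cong-≤ (suc n) p q = +-cong (*-cong (p 0 z≤n) (q (suc n) ℕ.≤-refl))
    (*ₛ-cong-≤ n (λ m m≤n → p (suc m) (s≤s m≤n)) (λ m m≤n → q m (ℕ.m≤n⇒m≤1+n m≤n)))

  *ₛ-cong : ∀ {f f′ g g′} → f ≈ₛ f′ → g ≈ₛ g′ → f *ₛ g ≈ₛ f′ *ₛ g′
  *ₛ-cong p q n = *ₛ-cong-≤ n (λ m _ → p m) (λ m _ → q m)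

  *ₛ-distribʳ : ∀ f g h → (f +ₛ g) *ₛ h ≈ₛ (f *ₛ h) +ₛ (g *ₛ h)
  *ₛ-distribʳ f g h zero    = begin
    (f 0 + g 0) * h 0 + 0#                ≈⟨ +-cong (distribʳ _ _ _) (sym (+-identityʳ 0#)) ⟩
    f 0 * h 0 + g 0 * h 0 + (0# + 0#)     ≈⟨ +.interchange _ _ _ _ ⟩
    (f *ₛ h) 0 + (g *ₛ h) 0               ∎
  *ₛ-distribʳ f g h (suc n) = begin
    (f 0 + g 0) * h (suc n) + ((tail f +ₛ tail g) *ₛ h) n
      ≈⟨ +-cong (distribʳ _ _ _) (*ₛ-distribʳ (tail f) (tail g) h n) ⟩
    f 0 * h (suc n) + g 0 * h (suc n) + ((tail f *ₛ h) n + (tail g *ₛ h) n)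
      ≈⟨ +.interchange _ _ _ _ ⟩
    (f *ₛ h) (suc n) + (g *ₛ h) (suc n) ∎

  ·-*ₛ-assoc : ∀ x f g → (x · f) *ₛ g ≈ₛ x · (f *ₛ g)
  ·-*ₛ-assoc x f g zero    = begin
    x * f 0 * g 0 + 0#         ≈⟨ +-cong (*-assoc _ _ _) (sym (zeroʳ x)) ⟩
    x * (f 0 * g 0) + x * 0#   ≈⟨ distribˡ _ _ _ ⟨
    x * (f 0 * g 0 + 0#)       ∎
  ·-*ₛ-assoc x f g (suc n) = begin
    x * f 0 * g (suc n) + ((x · tail f) *ₛ g) n     ≈⟨ +-cong (*-assoc _ _ _) (·-*ₛ-assoc x (tail f) g n) ⟩
    x * (f 0 * g (suc n)) + x * (tail f *ₛ g) n     ≈⟨ distribˡ _ _ _ ⟨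
    x * (f *ₛ g) (suc n)                            ∎

  -- `tail (f *ₛ g)` reduces to `(f 0 · tail g) +ₛ (tail f *ₛ g)`, so distributivity and the
  -- induction hypothesis for `tail f` suffice.
  *ₛ-assoc : ∀ f g h → (f *ₛ g) *ₛ h ≈ₛ f *ₛ (g *ₛ h)
  *ₛ-assoc f g h zero    = +-congʳ (begin
    (f 0 * g 0 + 0#) * h 0   ≈⟨ *-congʳ (+-identityʳ _) ⟩
    f 0 * g 0 * h 0          ≈⟨ *-assoc _ _ _ ⟩
    f 0 * (g 0 * h 0)        ≈⟨ *-congˡ (+-identityʳ _) ⟨
    f 0 * (g 0 * h 0 + 0#)   ∎)
  *ₛ-assoc f g h (suc n) = begin
    (f 0 * g 0 + 0#) * h (suc n) + (((f 0 · tail g) +ₛ (tail f *ₛ g)) *ₛ h) n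
      ≈⟨ +-cong (trans (*-congʳ (+-identityʳ _)) (*-assoc _ _ _)) (*ₛ-distribʳ (f 0 · tail g) (tail f *ₛ g) h n) ⟩
    f 0 * (g 0 * h (suc n)) + (((f 0 · tail g) *ₛ h) n + ((tail f *ₛ g) *ₛ h) n)
      ≈⟨ +-congˡ (+-cong (·-*ₛ-assoc (f 0) (tail g) h n) (*ₛ-assoc (tail f) g h n)) ⟩
    f 0 * (g 0 * h (suc n)) + (f 0 * (tail g *ₛ h) n + (tail f *ₛ (g *ₛ h)) n)
      ≈⟨ +-assoc _ _ _ ⟨
    f 0 * (g 0 * h (suc n)) + f 0 * (tail g *ₛ h) n + (tail f *ₛ (g *ₛ h)) n
      ≈⟨ +-congʳ (distribˡ _ _ _) ⟨
    f 0 * (g *ₛ h) (suc n) + (tail f *ₛ (g *ₛ h)) n ∎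

  -- Splits off the opposite end of the sum from the one where the product reduces; commutativity
  -- compares the two unfoldings.
  *ₛ-unfoldʳ : ∀ f g n → (f *ₛ g) (suc n) ≈ f (suc n) * g 0 + (f *ₛ tail g) n
  *ₛ-unfoldʳ f g zero    = begin
    f 0 * g 1 + (f 1 * g 0 + 0#)   ≈⟨ +.x∙yz≈y∙xz _ _ _ ⟩
    f 1 * g 0 + (f 0 * g 1 + 0#)   ∎
  *ₛ-unfoldʳ f g (suc n) = begin
    f 0 * g (suc (suc n)) + (tail f *ₛ g) (suc n)
      ≈⟨ +-congˡ (*ₛ-unfoldʳ (tail f) g n) ⟩
    f 0 * g (suc (suc n)) + (f (suc (suc n)) * g 0 + (tail f *ₛ tail g) n)
      ≈⟨ +.x∙yz≈y∙xz _ _ _ ⟩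
    f (suc (suc n)) * g 0 + (f 0 * g (suc (suc n)) + (tail f *ₛ tail g) n) ∎

  *ₛ-comm : ∀ f g → f *ₛ g ≈ₛ g *ₛ f
  *ₛ-comm f g zero    = +-congʳ (*-comm _ _)
  *ₛ-comm f g (suc n) = begin
    (f *ₛ g) (suc n)                      ≈⟨ *ₛ-unfoldʳ f g n ⟩
    f (suc n) * g 0 + (f *ₛ tail g) n     ≈⟨ +-cong (*-comm _ _) (*ₛ-comm f (tail g) n) ⟩
    (g *ₛ f) (suc n)                      ∎

  *ₛ-identityˡ : ∀ f → 1ₛ *ₛ f ≈ₛ f
  *ₛ-identityˡ f zero    = trans (+-identityʳ _) (*-identityˡ _)
  *ₛ-identityˡ f (suc n) = trans (+-cong (*-identityˡ _) (zero-*ₛ n)) (+-identityʳ _)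
    where
    zero-*ₛ : ∀ n → ((λ _ → 0#) *ₛ f) n ≈ 0#
    zero-*ₛ zero    = trans (+-identityʳ _) (zeroˡ _)
    zero-*ₛ (suc n) = trans (+-cong (zeroˡ _) (zero-*ₛ n)) (+-identityʳ _)

  scale-*ₛ : ∀ x f g → scale x (f *ₛ g) ≈ₛ scale x f *ₛ scale x g
  scale-*ₛ x f g zero    = begin
    1# * (f 0 * g 0 + 0#)           ≈⟨ *-identityˡ _ ⟩
    f 0 * g 0 + 0#                  ≈⟨ +-congʳ (*-cong (*-identityˡ _) (*-identityˡ _)) ⟨
    (1# * f 0) * (1# * g 0) + 0#    ∎
  scale-*ₛ x f g (suc n) = begin
    x ^ suc n * (f 0 * g (suc n) + (tail f *ₛ g) n)
      ≈⟨ distribˡ _ _ _ ⟩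
    x ^ suc n * (f 0 * g (suc n)) + x * x ^ n * (tail f *ₛ g) n
      ≈⟨ +-cong (trans (*.x∙yz≈y∙xz _ _ _) (*-congʳ (sym (*-identityˡ _)))) (trans (*-assoc _ _ _) (*-congˡ (scale-*ₛ x (tail f) g n))) ⟩
    scale x f 0 * scale x g (suc n) + x * (scale x (tail f) *ₛ scale x g) n
      ≈⟨ +-congˡ (·-*ₛ-assoc x (scale x (tail f)) (scale x g) n) ⟨
    scale x f 0 * scale x g (suc n) + ((x · scale x (tail f)) *ₛ scale x g) n
      ≈⟨ +-congˡ (*ₛ-cong (λ m → sym (*-assoc x (x ^ m) (tail f m))) (λ m → ≈-refl {scale x g m}) n) ⟩
    (scale x f *ₛ scale x g) (suc n) ∎

  scale-cong : ∀ x {f g} → f ≈ₛ g → scale x f ≈ₛ scale x g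
  scale-cong x p n = *-congˡ (p n)

  scale-1# : ∀ f → scale 1# f ≈ₛ f
  scale-1# f n = trans (*-congʳ (1^ n)) (*-identityˡ _)
    where
    1^ : ∀ n → 1# ^ n ≈ 1#
    1^ zero    = ≈-refl
    1^ (suc n) = trans (*-identityˡ _) (1^ n)

  recip-unique : ∀ f g → f 0 ≈ 1# → f *ₛ g ≈ₛ 1ₛ → g ≈ₛ recip f
  recip-unique f g f₀ fg≈1 n = begin
    g n                       ≈⟨ *ₛ-identityˡ g n ⟨
    (1ₛ *ₛ g) n               ≈⟨ *ₛ-cong (recip-inverse f f₀) (λ m → ≈-refl {g m}) n ⟨
    ((f *ₛ r) *ₛ g) n         ≈⟨ *ₛ-cong (*ₛ-comm f r) (λ m → ≈-refl {g m}) n ⟩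
    ((r *ₛ f) *ₛ g) n         ≈⟨ *ₛ-assoc r f g n ⟩
    (r *ₛ (f *ₛ g)) n         ≈⟨ *ₛ-cong (λ m → ≈-refl {r m}) fg≈1 n ⟩
    (r *ₛ 1ₛ) n               ≈⟨ *ₛ-comm r 1ₛ n ⟩
    (1ₛ *ₛ r) n               ≈⟨ *ₛ-identityˡ r n ⟩
    r n                       ∎
    where r = recip f

  -- One level 1/(1 - x z f) of a continued fraction; `convergent` at a successor is definitionally
  -- of this form.
  fractionStep : Carrier → Series → Series
  fractionStep x f = recip (λ n → 1ₛ n - x * (z· f) n)

  fractionStep-cong-≤ : ∀ {x y f g} n → x ≈ y → (∀ m → m ≤ n → f m ≈ g m) → fractionStep x f n ≈ fractionStep y g n
  fractionStep-cong-≤ n x≈y f≈g = recips-cong n (λ {m} → tails m) zero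
    where
    tails : ∀ m → m ≤ n → _
    tails zero    _   = +-congˡ (-‿cong (*-congʳ x≈y))
    tails (suc m) m<n = +-congˡ (-‿cong (*-cong x≈y (f≈g m (ℕ.≤-trans (ℕ.n≤1+n m) m<n))))

  private
    1-xz0≈1 : ∀ x → 1# - x * 0# ≈ 1#
    1-xz0≈1 x = trans (+-congˡ (trans (-‿cong (zeroʳ x)) -0#≈0#)) (+-identityʳ 1#)

  -- The inverse g of 1 - x z f satisfies g = 1 + x z f g, the shape of the equations for trees. The
  -- recursion behind `recip` is this equation up to sign.
  fractionStep-suc : ∀ x f n → fractionStep x f (suc n) ≈ x * (f *ₛ fractionStep x f) n
  fractionStep-suc x f n = begin
    - sum {suc n} (λ i → (0# - x * f (toℕ i)) * recips g n i)
      ≈⟨ -‿cong (sum-cong-≋ {suc n} λ i → *-cong (trans (+-identityˡ _) (-‿distribˡ-* x (f (toℕ i)))) (reflexive (recips-recip g n i))) ⟩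
    - (((- x) · f) *ₛ recip g) n           ≈⟨ -‿cong (·-*ₛ-assoc (- x) f (recip g) n) ⟩
    - ((- x) * (f *ₛ recip g) n)           ≈⟨ -‿distribˡ-* _ _ ⟩
    (- - x) * (f *ₛ recip g) n             ≈⟨ *-congʳ (-‿involutive x) ⟩
    x * (f *ₛ recip g) n                   ∎
    where g = λ n → 1ₛ n - x * (z· f) n

  -- Substitution is multiplicative and hence respects inverses; the factor z of the denominator
  -- contributes the extra `y`.
  scale-fractionStep : ∀ y x f → scale y (fractionStep x f) ≈ₛ fractionStep (y * x) (scale y f)
  scale-fractionStep y x f n = begin
    scale y (recip g) n  ≈⟨ recip-unique (scale y g) (scale y (recip g)) (trans (*-identityˡ _) (1-xz0≈1 x)) inverse n ⟩
    recip (scale y g) n  ≈⟨ recips-cong n (λ {m} _ → coefficients m) zero ⟩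
    fractionStep (y * x) (scale y f) n ∎
    where
    g = λ n → 1ₛ n - x * (z· f) n
    inverse : scale y g *ₛ scale y (recip g) ≈ₛ 1ₛ
    inverse m = begin
      (scale y g *ₛ scale y (recip g)) m   ≈⟨ scale-*ₛ y g (recip g) m ⟨
      scale y (g *ₛ recip g) m             ≈⟨ scale-cong y (recip-inverse g (1-xz0≈1 x)) m ⟩
      scale y 1ₛ m                         ≈⟨ scale-1ₛ m ⟩
      1ₛ m                                 ∎
      where
      scale-1ₛ : ∀ m → scale y 1ₛ m ≈ 1ₛ m
      scale-1ₛ zero    = *-identityˡ _
      scale-1ₛ (suc m) = zeroʳ _
    coefficients : ∀ m → scale y g m ≈ 1ₛ m - (y * x) * (z· scale y f) m
    coefficients zero    = trans (*-identityˡ _) (trans (1-xz0≈1 x) (sym (1-xz0≈1 (y * x))))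
    coefficients (suc m) = begin
      y * y ^ m * (0# - x * f m)       ≈⟨ *-congˡ (+-identityˡ _) ⟩
      y * y ^ m * - (x * f m)          ≈⟨ -‿distribʳ-* _ _ ⟨
      - (y * y ^ m * (x * f m))        ≈⟨ -‿cong (*.interchange _ _ _ _) ⟩
      - (y * x * (y ^ m * f m))        ≈⟨ +-identityˡ _ ⟨
      0# - y * x * (y ^ m * f m)       ∎

  -- The right-hand side at `n` uses coefficients up to `n` only, so strong induction applies;
  -- `below` carries the bound.
  affine-recurrence-unique : ∀ {f g} (s b : Series) → f 0 ≈ g 0 →
    (∀ n → f (suc n) ≈ b n + (s *ₛ f) n) → (∀ n → g (suc n) ≈ b n + (s *ₛ g) n) → f ≈ₛ g
  affine-recurrence-unique {f} {g} s b f₀≈g₀ f-suc g-suc n = below n n ℕ.≤-refl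
    where
    below : ∀ n m → m ≤ n → f m ≈ g m
    below _       zero    _         = f₀≈g₀
    below (suc n) (suc m) (s≤s m≤n) = begin
      f (suc m)          ≈⟨ f-suc m ⟩
      b m + (s *ₛ f) m   ≈⟨ +-congˡ (*ₛ-cong-≤ m (λ k _ → ≈-refl {s k}) (λ k k≤m → below n k (ℕ.≤-trans k≤m m≤n))) ⟩
      b m + (s *ₛ g) m   ≈⟨ g-suc m ⟨
      g (suc m)          ∎

-- Functional equations of the continued fraction

module CatalanSeries {a ℓ} (R : CommutativeRing a ℓ) (t q : CommutativeRing.Carrier R) where

  open CommutativeRing R hiding (zero; refl)
  open CommutativeRing R using () renaming (refl to ≈-refl)
  open import Algebra.Properties.Semiring.Exp semiring using (_^_)
  open import Algebra.Properties.CommutativeSemigroup +-commutativeSemigroup as + using ()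
  open import Relation.Binary.Reasoning.Setoid setoid
  open PowerSeries R
  open QTCatalan R t q
  open SeriesAlgebra R

  private
    parity : ∀ n → ∃ λ k → n ≡ k ℕ.* 2 ⊎ n ≡ suc (k ℕ.* 2)
    parity zero    = 0 , inj₁ refl
    parity (suc n) with parity n
    ... | k , inj₁ refl = k , inj₂ refl
    ... | k , inj₂ refl = suc k , inj₁ refl

  -- Both q^(k-1) and t q^(k-1) gain one factor q when k grows by one; the two parities are the two
  -- cases.
  c-periodic : ∀ k → c (suc (suc (suc k))) ≈ q * c (suc k)
  c-periodic k with parity k
  ... | j , inj₁ refl = trans (reflexive (c-odd (suc j))) (*-congˡ (reflexive (≡.sym (c-odd j))))
  ... | j , inj₂ refl = begin
    c (suc (suc (suc j ℕ.* 2)))   ≡⟨ c-even (suc j) ⟩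
    t * (q * q ^ j)               ≈⟨ x∙yz≈y∙xz t q (q ^ j) ⟩
    q * (t * q ^ j)               ≡⟨ ≡.cong (q *_) (c-even j) ⟨
    q * c (suc (suc (j ℕ.* 2)))   ∎
    where open import Algebra.Properties.CommutativeSemigroup *-commutativeSemigroup using (x∙yz≈y∙xz)

  -- Multiplying every coefficient of a fraction by q amounts to substituting q z for z. This closes
  -- the infinite fraction after two levels.
  convergent-periodic : ∀ N k → convergent c N (suc (suc (suc k))) ≈ₛ scale q (convergent c N (suc k))
  convergent-periodic zero    k zero    = sym (*-identityˡ _)
  convergent-periodic zero    k (suc n) = sym (zeroʳ _)
  convergent-periodic (suc N) k n = begin
    fractionStep (c (suc (suc (suc k)))) (convergent c N (suc (suc (suc (suc k))))) n
      ≈⟨ fractionStep-cong-≤ n (c-periodic k) (λ m _ → convergent-periodic N (suc k) m) ⟩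
    fractionStep (q * c (suc k)) (scale q (convergent c N (suc (suc k)))) n
      ≈⟨ scale-fractionStep q (c (suc k)) (convergent c N (suc (suc k))) n ⟨
    scale q (fractionStep (c (suc k)) (convergent c N (suc (suc k)))) n ∎

  -- C = 1/(1 - z D) and D = 1/(1 - t z C(qz)).
  D : Series
  D n = convergent c n 2 n

  private
    c₁≈1 : c 1 ≈ 1#
    c₁≈1 = reflexive (c-odd 0)

    c₂≈t : c 2 ≈ t
    c₂≈t = trans (reflexive (c-even 0)) (*-identityʳ t)

    -- `C` and `D` are diagonals of convergents. Unfolding a level of `C` at `n` needs the
    -- convergent of depth `suc n`, and its tail has depth `n` for all `m ≤ n` at once; stability of
    -- the coefficients reconciles the depths.
    C-step : C ≈ₛ fractionStep 1# D
    C-step n = trans (convergents-agree c 1 n ℕ.≤-refl (ℕ.n≤1+n n))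
      (fractionStep-cong-≤ n c₁≈1 (λ m m≤n → convergents-agree c 2 m m≤n ℕ.≤-refl))

    D-step : D ≈ₛ fractionStep t (scale q C)
    D-step n = trans (convergents-agree c 2 n ℕ.≤-refl (ℕ.n≤1+n n))
      (fractionStep-cong-≤ n c₂≈t (λ m m≤n →
        trans (convergent-periodic n 0 m) (*-congˡ (convergents-agree c 1 m m≤n ℕ.≤-refl))))

  C-suc : ∀ n → C (suc n) ≈ (D *ₛ C) n
  C-suc n = begin
    C (suc n)                       ≈⟨ C-step (suc n) ⟩
    fractionStep 1# D (suc n)       ≈⟨ fractionStep-suc 1# D n ⟩
    1# * (D *ₛ fractionStep 1# D) n ≈⟨ *-identityˡ _ ⟩
    (D *ₛ fractionStep 1# D) n      ≈⟨ *ₛ-cong (λ m → ≈-refl {D m}) C-step n ⟨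
    (D *ₛ C) n                      ∎

  D-suc : ∀ n → D (suc n) ≈ t * (scale q C *ₛ D) n
  D-suc n = begin
    D (suc n)                                          ≈⟨ D-step (suc n) ⟩
    fractionStep t (scale q C) (suc n)                 ≈⟨ fractionStep-suc t (scale q C) n ⟩
    t * (scale q C *ₛ fractionStep t (scale q C)) n    ≈⟨ *-congˡ (*ₛ-cong (λ m → ≈-refl {scale q C m}) D-step n) ⟨
    t * (scale q C *ₛ D) n                             ∎

  -- `P` and `K` are the X and Y of the second system. `K` satisfies its equation by construction,
  -- and that of `P` is `t` times `C-suc-PK`.
  P : Series
  P zero    = 1#
  P (suc n) = t * C (suc n)

  K : Series
  K = fractionStep 1# (scale q P)

  K-suc : ∀ n → K (suc n) ≈ (scale q P *ₛ K) n
  K-suc n = trans (fractionStep-suc 1# (scale q P) n) (*-identityˡ _)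

  -- P(qz) = (1 - t) + t C(qz), so that D C and P K both solve Y = P + z P(qz) Y.
  private
    P*K-suc : ∀ n → (P *ₛ K) (suc n) ≈ P (suc n) + (scale q P *ₛ (P *ₛ K)) n
    P*K-suc n = begin
      (P *ₛ K) (suc n)                             ≈⟨ *ₛ-unfoldʳ P K n ⟩
      P (suc n) * 1# + (P *ₛ tail K) n             ≈⟨ +-cong (*-identityʳ _) (*ₛ-cong (λ m → ≈-refl {P m}) K-suc n) ⟩
      P (suc n) + (P *ₛ (scale q P *ₛ K)) n        ≈⟨ +-congˡ (*ₛ-assoc P (scale q P) K n) ⟨
      P (suc n) + ((P *ₛ scale q P) *ₛ K) n        ≈⟨ +-congˡ (*ₛ-cong (*ₛ-comm P (scale q P)) (λ m → ≈-refl {K m}) n) ⟩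
      P (suc n) + ((scale q P *ₛ P) *ₛ K) n        ≈⟨ +-congˡ (*ₛ-assoc (scale q P) P K n) ⟩
      P (suc n) + (scale q P *ₛ (P *ₛ K)) n        ∎

    scaleP : scale q P ≈ₛ ((1# - t) · 1ₛ) +ₛ (t · scale q C)
    scaleP zero    = begin
      1# * 1#                           ≈⟨ *-identityˡ 1# ⟩
      1#                                ≈⟨ +-identityʳ 1# ⟨
      1# + 0#                           ≈⟨ +-congˡ (-‿inverseˡ t) ⟨
      1# + (- t + t)                    ≈⟨ +-assoc _ _ _ ⟨
      1# - t + t                        ≈⟨ +-cong (*-identityʳ _) (trans (*-congˡ (*-identityˡ 1#)) (*-identityʳ t)) ⟨
      (1# - t) * 1# + t * (1# * 1#)     ∎
    scaleP (suc n) = begin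
      q ^ suc n * (t * C (suc n))                       ≈⟨ x∙yz≈y∙xz _ _ _ ⟩
      t * (q ^ suc n * C (suc n))                       ≈⟨ +-identityˡ _ ⟨
      0# + t * (q ^ suc n * C (suc n))                  ≈⟨ +-congʳ (zeroʳ _) ⟨
      (1# - t) * 0# + t * (q ^ suc n * C (suc n))       ∎
      where open import Algebra.Properties.CommutativeSemigroup *-commutativeSemigroup using (x∙yz≈y∙xz)

    scaleP*DC : ∀ n → (scale q P *ₛ (D *ₛ C)) n ≈ (1# - t) * C (suc n) + (tail D *ₛ C) n
    scaleP*DC n = begin
      (scale q P *ₛ DC) n
        ≈⟨ *ₛ-cong scaleP (λ m → ≈-refl {DC m}) n ⟩
      ((((1# - t) · 1ₛ) +ₛ (t · scale q C)) *ₛ DC) n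
        ≈⟨ *ₛ-distribʳ ((1# - t) · 1ₛ) (t · scale q C) DC n ⟩
      (((1# - t) · 1ₛ) *ₛ DC) n + ((t · scale q C) *ₛ DC) n
        ≈⟨ +-cong (·-*ₛ-assoc (1# - t) 1ₛ DC n) (sym (*ₛ-assoc (t · scale q C) D C n)) ⟩
      (1# - t) * (1ₛ *ₛ DC) n + (((t · scale q C) *ₛ D) *ₛ C) n
        -- `C-suc` reads D C as the shift of `C`, and `D-suc` reads t C(qz) D as the shift of `D`.
        ≈⟨ +-cong (*-congˡ (trans (*ₛ-identityˡ DC n) (sym (C-suc n))))
                  (*ₛ-cong (λ m → trans (·-*ₛ-assoc t (scale q C) D m) (sym (D-suc m))) (λ m → ≈-refl {C m}) n) ⟩
      (1# - t) * C (suc n) + (tail D *ₛ C) n ∎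
      where DC = D *ₛ C

    D*C-suc : ∀ n → (D *ₛ C) (suc n) ≈ P (suc n) + (scale q P *ₛ (D *ₛ C)) n
    D*C-suc n = begin
      -- The coefficient 1 is split as t + (1 - t): the first part gives `P (suc n)`, the second the
      -- `(1# - t)` term of `scaleP*DC`.
      1# * x + y                            ≈⟨ +-congʳ (*-congʳ (+-identityʳ 1#)) ⟨
      (1# + 0#) * x + y                     ≈⟨ +-congʳ (*-congʳ (+-congˡ (-‿inverseʳ t))) ⟨
      (1# + (t - t)) * x + y                ≈⟨ +-congʳ (*-congʳ (+.x∙yz≈y∙xz 1# t (- t))) ⟩
      (t + (1# - t)) * x + y                ≈⟨ +-congʳ (distribʳ x t (1# - t)) ⟩
      t * x + (1# - t) * x + y              ≈⟨ +-assoc _ _ _ ⟩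
      t * x + ((1# - t) * x + y)            ≈⟨ +-congˡ (scaleP*DC n) ⟨
      t * x + (scale q P *ₛ (D *ₛ C)) n     ∎
      where
      x = C (suc n)
      y = (tail D *ₛ C) n

  C-suc-PK : ∀ n → C (suc n) ≈ (P *ₛ K) n
  C-suc-PK n = trans (C-suc n) (affine-recurrence-unique (scale q P) (tail P) ≈-refl D*C-suc P*K-suc n)

-- Binary trees

data Tree : Set where
  leaf : Tree
  node : Tree → Tree → Tree

size : Tree → ℕ
size leaf       = 0
size (node L R) = suc (size L ℕ.+ size R)

node-injective : ∀ {L L′ R R′} → node L R ≡ node L′ R′ → L ≡ L′ × R ≡ R′
node-injective refl = refl , refl

-- A Cauchy product of lists. It recurs by shifting `A`, as `*ₛ` does by passing to the tail, so
-- that `∑-nodes` is a direct induction.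
nodes : (ℕ → List Tree) → (ℕ → List Tree) → ℕ → List Tree
nodes A B zero    = cartesianProductWith node (A 0) (B 0)
nodes A B (suc n) = cartesianProductWith node (A 0) (B (suc n)) ++ nodes (A ∘ suc) B n

-- The trees of size n, provided that n is at most the height bound d.
trees : (d n : ℕ) → List Tree
trees d       zero    = leaf ∷ []
trees zero    (suc n) = []
trees (suc d) (suc n) = nodes (trees d) (trees d) n

∈-nodes⁺ : ∀ A B i j {L R} → L ∈ A i → R ∈ B j → node L R ∈ nodes A B (i ℕ.+ j)
∈-nodes⁺ A B zero    zero    L∈ R∈ = ∈-cartesianProductWith⁺ node L∈ R∈
∈-nodes⁺ A B zero    (suc j) L∈ R∈ = ∈-++⁺ˡ (∈-cartesianProductWith⁺ node L∈ R∈)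
∈-nodes⁺ A B (suc i) j       L∈ R∈ = ∈-++⁺ʳ (cartesianProductWith node (A 0) _) (∈-nodes⁺ (A ∘ suc) B i j L∈ R∈)

∈-nodes⁻ : ∀ A B n {T} → T ∈ nodes A B n →
  ∃₂ λ i j → i ℕ.+ j ≡ n × ∃₂ λ L R → L ∈ A i × R ∈ B j × T ≡ node L R
∈-nodes⁻ A B zero    T∈ with ∈-cartesianProductWith⁻ node (A 0) (B 0) T∈
... | L , R , L∈ , R∈ , eq = 0 , 0 , refl , L , R , L∈ , R∈ , eq
∈-nodes⁻ A B (suc n) T∈ with ∈-++⁻ (cartesianProductWith node (A 0) (B (suc n))) T∈
... | inj₁ T∈ˡ with ∈-cartesianProductWith⁻ node (A 0) (B (suc n)) T∈ˡ
...   | L , R , L∈ , R∈ , eq = 0 , suc n , refl , L , R , L∈ , R∈ , eq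
∈-nodes⁻ A B (suc n) T∈ | inj₂ T∈ʳ with ∈-nodes⁻ (A ∘ suc) B n T∈ʳ
...   | i , j , refl , rest = suc i , j , refl , rest

∈-trees⁻ : ∀ d n {T} → T ∈ trees d n → size T ≡ n
∈-trees⁻ d       zero    (here refl) = refl
∈-trees⁻ (suc d) (suc n) T∈ with ∈-nodes⁻ (trees d) (trees d) n T∈
... | i , j , refl , L , R , L∈ , R∈ , refl = cong suc (cong₂ ℕ._+_ (∈-trees⁻ d i L∈) (∈-trees⁻ d j R∈))

∈-trees⁺ : ∀ d T → size T ≤ d → T ∈ trees d (size T)
∈-trees⁺ d       leaf       _         = here refl
∈-trees⁺ (suc d) (node L R) (s≤s l+r≤d) = ∈-nodes⁺ (trees d) (trees d) (size L) (size R)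
  (∈-trees⁺ d L (ℕ.≤-trans (ℕ.m≤m+n (size L) (size R)) l+r≤d))
  (∈-trees⁺ d R (ℕ.≤-trans (ℕ.m≤n+m (size R) (size L)) l+r≤d))

-- `k` records how far `A` has been shifted. The left subtrees in the first block have size `k` and
-- those in the later blocks a larger size, which makes the blocks disjoint.
nodes-unique : ∀ A B k → (∀ i → Unique (A i)) → (∀ j → Unique (B j)) →
  (∀ i {L} → L ∈ A i → size L ≡ i ℕ.+ k) → ∀ n → Unique (nodes A B n)
nodes-unique A B k A! B! A-size zero    = Unique.cartesianProductWith⁺ node node-injective (A! 0) (B! 0)
nodes-unique A B k A! B! A-size (suc n) = Unique.++⁺
  (Unique.cartesianProductWith⁺ node node-injective (A! 0) (B! (suc n)))
  (nodes-unique (A ∘ suc) B (suc k) (A! ∘ suc) B! (λ i L∈ → ≡.trans (A-size (suc i) L∈) (≡.sym (ℕ.+-suc i k))) n)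
  disjoint
  where
  disjoint : ∀ {T} → T ∈ cartesianProductWith node (A 0) (B (suc n)) × T ∈ nodes (A ∘ suc) B n → _
  disjoint (T∈ˡ , T∈ʳ)
    with ∈-cartesianProductWith⁻ node (A 0) (B (suc n)) T∈ˡ | ∈-nodes⁻ (A ∘ suc) B n T∈ʳ
  ... | L , R , L∈ , R∈ , refl | i , j , _ , L , R , L∈′ , R∈′ , refl
    = ℕ.m+1+n≢m k (≡.trans (ℕ.+-comm k (suc i)) (≡.trans (≡.sym (A-size (suc i) L∈′)) (A-size 0 L∈)))

trees-unique : ∀ d n → Unique (trees d n)
trees-unique d       zero    = [] ∷ []
trees-unique zero    (suc n) = []
trees-unique (suc d) (suc n) = nodes-unique (trees d) (trees d) 0 (trees-unique d) (trees-unique d)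
  (λ i L∈ → ≡.trans (∈-trees⁻ d i L∈) (≡.sym (ℕ.+-identityʳ i))) n

-- The position of the letter preceding a factor relative to the letters of the factor.
data Context : Set where
  above below : Context

treeStat : (Context → ℕ → ℕ → ℕ) → Context → Tree → ℕ
treeStat s c leaf       = 0
treeStat s c (node L R) = s c (size L) (size R) ℕ.+ (treeStat s above L ℕ.+ treeStat s below R)

-- No letter precedes the first letter of the whole word, so the root itself contributes nothing.
rootStat : (Context → ℕ → ℕ → ℕ) → Tree → ℕ
rootStat s leaf       = 0
rootStat s (node L R) = treeStat s above L ℕ.+ treeStat s below R

-- Generating functions of trees with multiplicative weights

module ListSums {a ℓ} (R : CommutativeRing a ℓ) where

  open CommutativeRing R hiding (zero; refl)
  open CommutativeRing R using () renaming (refl to ≈-refl)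
  open import Algebra.Properties.CommutativeSemigroup +-commutativeSemigroup using (x∙yz≈y∙xz)
  open import Relation.Binary.Reasoning.Setoid setoid
  open PowerSeries R

  ∑ : ∀ {b} {A : Set b} → List A → (A → Carrier) → Carrier
  ∑ xs w = List.foldr _+_ 0# (map w xs)

  ∑-cong : ∀ {b} {A : Set b} {v w : A → Carrier} (xs : List A) → (∀ {x} → x ∈ xs → v x ≈ w x) → ∑ xs v ≈ ∑ xs w
  ∑-cong []       v≈w = ≈-refl
  ∑-cong (x ∷ xs) v≈w = +-cong (v≈w (here refl)) (∑-cong xs (v≈w ∘ there))

  ∑-map : ∀ {b b′} {A : Set b} {B : Set b′} (f : A → B) (w : B → Carrier) xs → ∑ (map f xs) w ≈ ∑ xs (w ∘ f)
  ∑-map f w []       = ≈-refl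
  ∑-map f w (x ∷ xs) = +-congˡ (∑-map f w xs)

  ∑-↭ : ∀ {b} {A : Set b} {xs ys : List A} (w : A → Carrier) → xs ↭ ys → ∑ xs w ≈ ∑ ys w
  ∑-↭ w ↭.refl         = ≈-refl
  ∑-↭ w (↭.prep x p)   = +-congˡ (∑-↭ w p)
  ∑-↭ w (↭.swap x y p) = trans (x∙yz≈y∙xz _ _ _) (+-congˡ (+-congˡ (∑-↭ w p)))
  ∑-↭ w (↭.trans p p′) = trans (∑-↭ w p) (∑-↭ w p′)

  ∑-++ : ∀ {b} {A : Set b} (w : A → Carrier) xs ys → ∑ (xs ++ ys) w ≈ ∑ xs w + ∑ ys w
  ∑-++ w []       ys = sym (+-identityˡ _)
  ∑-++ w (x ∷ xs) ys = trans (+-congˡ (∑-++ w xs ys)) (sym (+-assoc _ _ _))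

  *-∑ : ∀ {b} {A : Set b} x (w : A → Carrier) xs → ∑ xs (λ y → x * w y) ≈ x * ∑ xs w
  *-∑ x w []       = sym (zeroʳ x)
  *-∑ x w (y ∷ xs) = trans (+-congˡ (*-∑ x w xs)) (sym (distribˡ _ _ _))

  module _ {w u v : Tree → Carrier} (w-node : ∀ L R → w (node L R) ≈ u L * v R) where

    ∑-cartesianProduct : ∀ xs ys → ∑ (cartesianProductWith node xs ys) w ≈ ∑ xs u * ∑ ys v
    ∑-cartesianProduct []       ys = sym (zeroˡ _)
    ∑-cartesianProduct (x ∷ xs) ys = begin
      ∑ (map (node x) ys ++ cartesianProductWith node xs ys) w
        ≈⟨ ∑-++ w (map (node x) ys) _ ⟩
      ∑ (map (node x) ys) w + ∑ (cartesianProductWith node xs ys) w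
        ≈⟨ +-cong (trans (∑-map (node x) w ys) (∑-cong ys (λ {y} _ → w-node x y))) (∑-cartesianProduct xs ys) ⟩
      ∑ ys (λ y → u x * v y) + ∑ xs u * ∑ ys v
        ≈⟨ +-congʳ (*-∑ (u x) v ys) ⟩
      u x * ∑ ys v + ∑ xs u * ∑ ys v
        ≈⟨ distribʳ _ _ _ ⟨
      (u x + ∑ xs u) * ∑ ys v ∎

    -- By distributivity, a weight that factors at every node turns the Cauchy product of lists into
    -- that of series.
    ∑-nodes : ∀ A B n → ∑ (nodes A B n) w ≈ ((λ i → ∑ (A i) u) *ₛ (λ j → ∑ (B j) v)) n
    ∑-nodes A B zero    = trans (∑-cartesianProduct (A 0) (B 0)) (sym (+-identityʳ _))
    ∑-nodes A B (suc n) = trans (∑-++ w (cartesianProductWith node (A 0) (B (suc n))) _)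
      (+-cong (∑-cartesianProduct (A 0) (B (suc n))) (∑-nodes (A ∘ suc) B n))

module TreeSums {a ℓ} (R : CommutativeRing a ℓ) (t q : CommutativeRing.Carrier R)
  (d s : Context → ℕ → ℕ → ℕ)
  where

  open CommutativeRing R hiding (zero; refl)
  open CommutativeRing R using () renaming (refl to ≈-refl)
  open import Algebra.Properties.Semiring.Exp semiring using (_^_; ^-homo-*)
  open import Algebra.Properties.CommutativeSemigroup *-commutativeSemigroup using (interchange)
  open import Relation.Binary.Reasoning.Setoid setoid
  open PowerSeries R
  open SeriesAlgebra R
  open ListSums R

  weight : Context → Tree → Carrier
  weight c T = t ^ treeStat d c T * q ^ treeStat s c T

  rootWeight : Tree → Carrier
  rootWeight T = t ^ rootStat d T * q ^ rootStat s T

  private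
    monomial-+ : ∀ i j k l → t ^ (i ℕ.+ j) * q ^ (k ℕ.+ l) ≈ (t ^ i * q ^ k) * (t ^ j * q ^ l)
    monomial-+ i j k l = trans (*-cong (^-homo-* t i j) (^-homo-* q k l)) (interchange _ _ _ _)

    rootWeight-node : ∀ L R → rootWeight (node L R) ≈ weight above L * weight below R
    rootWeight-node L R = monomial-+ (treeStat d above L) _ (treeStat s above L) _

  -- `α` is the factor of a node irrespective of sizes; `κ` and `μ` are factors per letter of the
  -- left and the right subtree, which become substitutions in the series. A candidate solution `X`
  -- is supplied, so each system is verified rather than solved.
  module _ (α κ μ : Context → Carrier)
    (coefficient : ∀ c l r → t ^ d c l r * q ^ s c l r ≈ α c * (κ c ^ l * μ c ^ r))
    (X : Context → Series) (X-zero : ∀ c → X c 0 ≈ 1#)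
    (X-suc : ∀ c n → X c (suc n) ≈ α c * (scale (κ c) (X above) *ₛ scale (μ c) (X below)) n)
    where

    private
      weight-node : ∀ c L R → weight c (node L R) ≈
        (α c * (κ c ^ size L * weight above L)) * (μ c ^ size R * weight below R)
      weight-node c L R = begin
        weight c (node L R)
          ≈⟨ monomial-+ (d c (size L) (size R)) _ (s c (size L) (size R)) _ ⟩
        (t ^ d c (size L) (size R) * q ^ s c (size L) (size R)) * rootWeight (node L R)
          ≈⟨ *-cong (coefficient c (size L) (size R)) (rootWeight-node L R) ⟩
        (α c * (κ c ^ size L * μ c ^ size R)) * (weight above L * weight below R)
          ≈⟨ *-assoc _ _ _ ⟩
        α c * ((κ c ^ size L * μ c ^ size R) * (weight above L * weight below R))
          ≈⟨ *-congˡ (interchange _ _ _ _) ⟩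
        α c * ((κ c ^ size L * weight above L) * (μ c ^ size R * weight below R))
          ≈⟨ *-assoc _ _ _ ⟨
        (α c * (κ c ^ size L * weight above L)) * (μ c ^ size R * weight below R) ∎

      ∑-scaled : ∀ x c h n → ∑ (trees h n) (λ T → x ^ size T * weight c T) ≈ x ^ n * ∑ (trees h n) (weight c)
      ∑-scaled x c h n = trans
        (∑-cong (trees h n) (λ T∈ → *-congʳ (reflexive (cong (x ^_) (∈-trees⁻ h n T∈)))))
        (*-∑ (x ^ n) (weight c) (trees h n))

    -- Induction on the height bound. The two subtrees have sizes at most `n`, hence within the
    -- bound `h`, which is why the bounded congruence is used.
    ∑-weight : ∀ c h n → n ≤ h → ∑ (trees h n) (weight c) ≈ X c n
    ∑-weight c h       zero    _         = trans (+-identityʳ _) (trans (*-identityˡ _) (sym (X-zero c)))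
    ∑-weight c (suc h) (suc n) (s≤s n≤h) = begin
      ∑ (nodes (trees h) (trees h) n) (weight c)
        ≈⟨ ∑-nodes (weight-node c) (trees h) (trees h) n ⟩
      ((λ i → ∑ (trees h i) (λ T → α c * (κ c ^ size T * weight above T))) *ₛ
       (λ j → ∑ (trees h j) (λ T → μ c ^ size T * weight below T))) n
        ≈⟨ *ₛ-cong-≤ n
             (λ i i≤n → trans (*-∑ (α c) _ (trees h i)) (*-congˡ (trans (∑-scaled (κ c) above h i)
               (*-congˡ (∑-weight above h i (ℕ.≤-trans i≤n n≤h))))))
             (λ j j≤n → trans (∑-scaled (μ c) below h j) (*-congˡ (∑-weight below h j (ℕ.≤-trans j≤n n≤h)))) ⟩
      ((α c · scale (κ c) (X above)) *ₛ scale (μ c) (X below)) n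
        ≈⟨ ·-*ₛ-assoc (α c) (scale (κ c) (X above)) (scale (μ c) (X below)) n ⟩
      α c * (scale (κ c) (X above) *ₛ scale (μ c) (X below)) n
        ≈⟨ X-suc c n ⟨
      X c (suc n) ∎

    ∑-rootWeight : ∀ n → ∑ (trees (suc n) (suc n)) rootWeight ≈ (X above *ₛ X below) n
    ∑-rootWeight n = trans (∑-nodes rootWeight-node (trees n) (trees n) n)
      (*ₛ-cong-≤ n (λ i i≤n → ∑-weight above n i i≤n) (λ j j≤n → ∑-weight below n j j≤n))

-- Contribution of the step from the preceding letter to the first letter a of a factor with `l`
-- letters below a and `r` above it. From below the step ascends over the `l` letters, from above it
-- descends over the `r` letters.
desᶜ ascᶜ 13-2ᶜ 31-2ᶜ : Context → ℕ → ℕ → ℕ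
desᶜ above l r = 1
desᶜ below l r = 0
ascᶜ above l r = 0
ascᶜ below l r = 1
13-2ᶜ above l r = 0
13-2ᶜ below l r = l
31-2ᶜ above l r = r
31-2ᶜ below l r = 0

-- The four systems evaluated

module CatalanTrees {a ℓ} (R : CommutativeRing a ℓ) (t q : CommutativeRing.Carrier R) where

  open CommutativeRing R hiding (zero; refl)
  open CommutativeRing R using () renaming (refl to ≈-refl)
  open import Algebra.Properties.Semiring.Exp semiring using (_^_)
  open PowerSeries R
  open QTCatalan R t q
  open SeriesAlgebra R
  open CatalanSeries R t q
  open ListSums R
  open TreeSums R t q

  private
    1^ : ∀ n → 1# ≈ 1# ^ n
    1^ zero    = ≈-refl
    1^ (suc n) = trans (1^ n) (sym (*-identityˡ _))

    constant : ∀ {x y} l r → x ≈ y → x * 1# ≈ y * (1# ^ l * 1# ^ r)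
    constant l r x≈y = *-cong x≈y (trans (sym (*-identityˡ 1#)) (*-cong (1^ l) (1^ r)))

    powerˡ : ∀ {x y} l r → x ≈ y → x * q ^ l ≈ y * (q ^ l * 1# ^ r)
    powerˡ l r x≈y = *-cong x≈y (trans (sym (*-identityʳ _)) (*-congˡ (1^ r)))

    powerʳ : ∀ {x y} l r → x ≈ y → x * q ^ r ≈ y * (1# ^ l * q ^ r)
    powerʳ l r x≈y = *-cong x≈y (trans (sym (*-identityˡ _)) (*-congʳ (1^ l)))

    unscaled : ∀ x {f} g h → f ≈ₛ x · (g *ₛ h) → f ≈ₛ x · (scale 1# g *ₛ scale 1# h)
    unscaled x g h f≈ n = trans (f≈ n) (*-congˡ (sym (*ₛ-cong (scale-1# g) (scale-1# h) n)))

    scaledˡ : ∀ x {f} g h → f ≈ₛ x · (scale q g *ₛ h) → f ≈ₛ x · (scale q g *ₛ scale 1# h)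
    scaledˡ x g h f≈ n = trans (f≈ n) (*-congˡ (*ₛ-cong (λ m → ≈-refl {scale q g m}) (λ m → sym (scale-1# h m)) n))

    scaledʳ : ∀ x {f} g h → f ≈ₛ x · (g *ₛ scale q h) → f ≈ₛ x · (scale 1# g *ₛ scale q h)
    scaledʳ x g h f≈ n = trans (f≈ n) (*-congˡ (*ₛ-cong (λ m → sym (scale-1# g m)) (λ m → ≈-refl {scale q h m}) n))

    one : ∀ {x y} → x ≈ y → x ≈ 1# * y
    one x≈y = trans x≈y (sym (*-identityˡ _))

    trivial : ∀ s → rootWeight desᶜ s leaf + 0# ≈ C 0
    trivial s = trans (+-identityʳ _) (*-identityˡ 1#)

    αᵈ αᵃ κᵘ κᵈ : Context → Carrier
    αᵈ above = t
    αᵈ below = 1#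
    αᵃ above = 1#
    αᵃ below = t
    κᵘ above = 1#
    κᵘ below = q
    κᵈ above = q
    κᵈ below = 1#

    t¹ : t ^ 1 ≈ t
    t¹ = *-identityʳ t

  des-31-2-sum : ∀ n → ∑ (trees n n) (rootWeight desᶜ 31-2ᶜ) ≈ C n
  des-31-2-sum zero    = trivial 31-2ᶜ
  des-31-2-sum (suc n) = trans
    (∑-rootWeight desᶜ 31-2ᶜ αᵈ (λ _ → 1#) κᵈ
      (λ { above l r → powerʳ l r t¹ ; below l r → constant l r ≈-refl })
      -- With X = `D` and Y = `C` the product X Y at the root is the shift of `C`, by `C-suc`.
      (λ { above → D ; below → C }) (λ { above → ≈-refl ; below → ≈-refl })
      (λ { above → scaledʳ t D C (λ m → trans (D-suc m) (*-congˡ (*ₛ-comm (scale q C) D m)))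
         ; below → unscaled 1# D C (λ m → one (C-suc m)) }) n)
    (sym (C-suc n))

  asc-13-2-sum : ∀ n → ∑ (trees n n) (rootWeight ascᶜ 13-2ᶜ) ≈ C n
  asc-13-2-sum zero    = trivial 13-2ᶜ
  asc-13-2-sum (suc n) = trans
    (∑-rootWeight ascᶜ 13-2ᶜ αᵃ κᵘ (λ _ → 1#)
      (λ { above l r → constant l r ≈-refl ; below l r → powerˡ l r t¹ })
      (λ { above → C ; below → D }) (λ { above → ≈-refl ; below → ≈-refl })
      (λ { above → unscaled 1# C D (λ m → one (C-suc′ m))
         ; below → scaledˡ t C D D-suc }) n)
    (sym (C-suc′ n))
    where
    C-suc′ : ∀ m → C (suc m) ≈ (C *ₛ D) m
    C-suc′ m = trans (C-suc m) (*ₛ-comm D C m)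

  des-13-2-sum : ∀ n → ∑ (trees n n) (rootWeight desᶜ 13-2ᶜ) ≈ C n
  des-13-2-sum zero    = trivial 13-2ᶜ
  des-13-2-sum (suc n) = trans
    (∑-rootWeight desᶜ 13-2ᶜ αᵈ κᵘ (λ _ → 1#)
      (λ { above l r → constant l r t¹ ; below l r → powerˡ l r ≈-refl })
      (λ { above → P ; below → K }) (λ { above → ≈-refl ; below → ≈-refl })
      (λ { above → unscaled t P K (λ m → *-congˡ (C-suc-PK m))
         ; below → scaledˡ 1# P K (λ m → one (K-suc m)) }) n)
    (sym (C-suc-PK n))

  asc-31-2-sum : ∀ n → ∑ (trees n n) (rootWeight ascᶜ 31-2ᶜ) ≈ C n
  asc-31-2-sum zero    = trivial 31-2ᶜ
  asc-31-2-sum (suc n) = trans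
    (∑-rootWeight ascᶜ 31-2ᶜ αᵃ (λ _ → 1#) κᵈ
      (λ { above l r → powerʳ l r ≈-refl ; below l r → constant l r t¹ })
      (λ { above → K ; below → P }) (λ { above → ≈-refl ; below → ≈-refl })
      (λ { above → scaledʳ 1# K P (λ m → one (trans (K-suc m) (*ₛ-comm (scale q P) K m)))
         ; below → unscaled t K P (λ m → *-congˡ (C-suc-KP m)) }) n)
    (sym (C-suc-KP n))
    where
    C-suc-KP : ∀ m → C (suc m) ≈ (K *ₛ P) m
    C-suc-KP m = trans (C-suc-PK m) (*ₛ-comm P K m)

-- 231-avoiding permutations

module _ where

  open import Algebra.Properties.CommutativeMonoid.Sum ℕ.+-0-commutativeMonoid using (sum; sum-cong-≗; ∑-comm; sum-permute; sum-replicate-zero)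
  open import Data.Bool.Base using (Bool; true; false; _∧_)
  open import Data.Bool.Properties using (∧-comm; ∧-zeroʳ)
  open import Data.Empty using (⊥; ⊥-elim)
  open import Data.Fin.Base as Fin using (Fin; zero; suc; toℕ; fromℕ<; opposite)
  open import Data.Fin.Patterns using (0F; 1F; 2F)
  open import Data.Fin.Permutation using (reverse)
  import Data.Fin.Properties as Fin
  open import Data.List.Base using (List; []; _∷_; _++_; map; length; filter; applyUpTo; cartesianProduct; upTo)
  open import Data.List.Membership.Propositional using (_∈_)
  open import Data.List.Membership.Propositional.Properties using (∈-map⁺; ∈-map⁻)
  open import Data.List.Membership.Propositional.Properties.WithK using (unique∧set⇒bag)
  open import Data.List.Properties using (filter-++; length-++)
  open import Data.List.Relation.Binary.BagAndSetEquality using (∼bag⇒↭)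
  open import Data.List.Relation.Binary.Permutation.Propositional using (_↭_)
  open import Data.List.Relation.Unary.All as All using (All; []; _∷_)
  import Data.List.Relation.Unary.All.Properties as All
  open import Data.List.Relation.Unary.AllPairs using ([]; _∷_)
  open import Data.List.Relation.Unary.Any using (here; there)
  open import Data.List.Relation.Unary.Unique.Propositional using (Unique)
  import Data.List.Relation.Unary.Unique.Propositional.Properties as Unique
  open import Data.Nat.Base as ℕ using (ℕ; zero; suc; _+_; _∸_; _≤_; _<_; z≤n; s≤s; s≤s⁻¹; _<ᵇ_; pred)
  open import Data.Nat.DivMod using (_mod_; m<n⇒m%n≡m; m%n<n)
  open import Data.Nat.Properties
  open import Data.Product.Base using (_×_; _,_; proj₁; proj₂; ∃; ∃₂)
  open import Data.Sum.Base using (_⊎_; inj₁; inj₂)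
  open import Data.Unit.Base using (⊤; tt)
  open import Data.Vec.Base using ([]; _∷_; lookup; tabulate)
  open import Data.Vec.Properties using (lookup∘tabulate; tabulate∘lookup; tabulate-cong)
  open import Function.Base using (_∘_; id)
  open import Function.Bundles using (Equivalence; _⇔_; mk⇔)
  open import Relation.Binary.Definitions using (tri<; tri≈; tri>)
  open import Relation.Binary.PropositionalEquality
  open import Relation.Nullary.Decidable using (yes; no; dec-true; dec-false; Dec; does; does-⇔; True; False; toWitness; toWitnessFalse; _×-dec_; _⊎-dec_)
  open import Relation.Nullary.Negation using (¬_; contradiction)

  -- Locates a position behind the first letter in the left or the right factor. The offset is
  -- written `k + l` so that `suc k + l` reduces, in agreement with the shift in `Rep`.
  data Split (l r : ℕ) : ℕ → Set where
    left  : ∀ {i} → i < l → Split l r i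
    right : ∀ k → k < r → Split l r (k + l)

  split : ∀ l r i → i < l + r → Split l r i
  split zero    r i       i<r   = subst (Split 0 r) (+-identityʳ i) (right i i<r)
  split (suc l) r zero    _     = left (s≤s z≤n)
  split (suc l) r (suc i) (s≤s i<l+r) with split l r i i<l+r
  ... | left i<l    = left (s≤s i<l)
  ... | right k k<r = subst (Split (suc l) r) (+-suc k l) (right k k<r)

  -- F 1 … F (size T) is the 231-avoiding arrangement of v+1 … v+size T encoded by T:
  -- its first letter a is followed by the arrangements of the letters below a (left subtree)
  -- and of the letters above a (right subtree).  F 0 is the letter preceding it.
  Rep : Tree → ℕ → (ℕ → ℕ) → Set
  Rep leaf       v F = ⊤
  Rep (node L R) v F = F 1 ≡ suc (v + size L) × Rep L v (F ∘ suc) × Rep R (suc (v + size L)) (λ i → F (suc (i + size L)))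

  Rep-bounds : ∀ T {v F} → Rep T v F → ∀ i → i < size T → v < F (suc i) × F (suc i) ≤ v + size T
  Rep-bounds (node L R) {v} (F₁ , repL , repR) zero _ rewrite F₁ =
    s≤s (m≤m+n v (size L)) , ≤-trans (s≤s (+-monoʳ-≤ v (m≤m+n (size L) (size R)))) (≤-reflexive (sym (+-suc v _)))
  Rep-bounds (node L R) {v} (F₁ , repL , repR) (suc i) (s≤s i<) with split (size L) (size R) i i<
  ... | left i<l    = let lo , hi = Rep-bounds L repL i i<l in
    lo , ≤-trans hi (+-monoʳ-≤ v (m≤n⇒m≤1+n (m≤m+n (size L) (size R))))
  ... | right k k<r = let lo , hi = Rep-bounds R repR k k<r in
    ≤-trans (s≤s (≤-trans (m≤m+n v (size L)) (n≤1+n _))) lo ,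
    ≤-trans hi (≤-reflexive (trans (cong suc (+-assoc v (size L) (size R))) (sym (+-suc v _))))

  module _ {L R : Tree} {v : ℕ} (F : ℕ → ℕ) (rep : Rep (node L R) v F) where

    private
      F₁   = proj₁ rep
      repL = proj₁ (proj₂ rep)
      repR = proj₂ (proj₂ rep)

    Rep-low : ∀ i → i < size L → F (suc (suc i)) < F 1
    Rep-low i i<l rewrite F₁ = s≤s (proj₂ (Rep-bounds L repL i i<l))

    Rep-high : ∀ k → k < size R → F 1 < F (suc (suc (k + size L)))
    Rep-high k k<r rewrite F₁ = proj₁ (Rep-bounds R repR k k<r)

    -- At `i = size L` this concerns the letter just before the right factor, and so puts that
    -- factor in the context `below`.
    Rep-prefix : ∀ i → i ≤ size L → F (suc i) ≤ F 1
    Rep-prefix zero    _   = ≤-refl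
    Rep-prefix (suc i) i<l = <⇒≤ (Rep-low i i<l)

  Rep-injective : ∀ T {v F} → Rep T v F → ∀ i j → i < j → j < size T → F (suc i) ≢ F (suc j)
  Rep-injective (node L R) {v} {F} rep zero (suc j) _ (s≤s j<) eq with split (size L) (size R) j j<
  ... | left j<l    = <⇒≢ (Rep-low F rep j j<l) (sym eq)
  ... | right k k<r = <⇒≢ (Rep-high F rep k k<r) eq
  Rep-injective (node L R) {v} {F} rep (suc i) (suc j) (s≤s i<j) (s≤s j<) eq
    with split (size L) (size R) i (<-trans i<j j<) | split (size L) (size R) j j<
  ... | left i<l  | left j<l    = Rep-injective L (proj₁ (proj₂ rep)) i j i<j j<l eq
  ... | left i<l  | right k k<r = <⇒≢ (<-trans (Rep-low F rep i i<l) (Rep-high F rep k k<r)) eq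
  ... | right k _ | left j<l    = contradiction (<-trans i<j j<l) (m+n≮n k (size L))
  ... | right k _ | right m m<r = Rep-injective R (proj₂ (proj₂ rep)) k m (+-cancelʳ-< (size L) k m i<j) m<r eq

  Rep-surjective : ∀ T {v F} → Rep T v F → ∀ x → v < x → x ≤ v + size T → ∃ λ i → i < size T × F (suc i) ≡ x
  Rep-surjective leaf {v} rep x v<x x≤v = contradiction v<x (≤⇒≯ (subst (x ≤_) (+-identityʳ v) x≤v))
  Rep-surjective (node L R) {v} (F₁ , repL , repR) x v<x x≤ with <-cmp x (suc (v + size L))
  ... | tri< x<a _ _ = let i , i<l , eq = Rep-surjective L repL x v<x (s≤s⁻¹ x<a) in
    suc i , s≤s (≤-trans i<l (m≤m+n _ _)) , eq
  ... | tri≈ _ refl _ = 0 , s≤s z≤n , F₁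
  ... | tri> _ _ a<x = let i , i<r , eq = Rep-surjective R repR x a<x
                             (≤-trans x≤ (≤-reflexive (trans (+-suc v _) (cong suc (sym (+-assoc v (size L) (size R))))))) in
    suc (i + size L) , s≤s (≤-trans (+-monoˡ-< (size L) i<r) (≤-reflexive (+-comm (size R) (size L)))) , eq

  -- The last letter of a 231 is smaller than its first, so it cannot lie in the right factor when
  -- the first is in the left one or is the root. If the root comes first, the middle letter lies in
  -- the right factor and so does the last. Otherwise all three lie in one factor.
  Rep-avoids : ∀ T {v F} → Rep T v F → ∀ i j k → i < j → j < k → k < size T →
    F (suc k) < F (suc i) → F (suc i) < F (suc j) → ⊥
  Rep-avoids (node L R) {v} {F} rep zero (suc j) (suc k) _ (s≤s j<k) (s≤s k<) k<i i<j
    with split (size L) (size R) j (<-trans j<k k<) | split (size L) (size R) k k<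
  ... | left j<l  | _           = <-asym i<j (Rep-low F rep j j<l)
  ... | right m _ | left k<l    = contradiction (<-trans j<k k<l) (m+n≮n m (size L))
  ... | right _ _ | right m m<r = <-asym k<i (Rep-high F rep m m<r)
  Rep-avoids (node L R) {v} {F} rep (suc i) (suc j) (suc k) (s≤s i<j) (s≤s j<k) (s≤s k<) Fk<Fi Fi<Fj
    with split (size L) (size R) i (<-trans i<j (<-trans j<k k<)) | split (size L) (size R) j (<-trans j<k k<) | split (size L) (size R) k k<
  ... | left i<l  | left j<l    | left k<l    = Rep-avoids L (proj₁ (proj₂ rep)) i j k i<j j<k k<l Fk<Fi Fi<Fj
  ... | left i<l  | _           | right m m<r = <-asym Fk<Fi (<-trans (Rep-low F rep i i<l) (Rep-high F rep m m<r))
  ... | left _    | right m _   | left k<l    = contradiction (<-trans j<k k<l) (m+n≮n m (size L))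
  ... | right m _ | left j<l    | _           = contradiction (<-trans i<j j<l) (m+n≮n m (size L))
  ... | right _ _ | right m _   | left k<l    = contradiction (<-trans j<k k<l) (m+n≮n m (size L))
  ... | right x _ | right y _   | right z z<r = Rep-avoids R (proj₂ (proj₂ rep)) x y z
    (+-cancelʳ-< (size L) x y i<j) (+-cancelʳ-< (size L) y z j<k) z<r Fk<Fi Fi<Fj

  -- The first letter determines the size of the left subtree, hence where the word is cut.
  Rep-unique-tree : ∀ T T′ {v F} → Rep T v F → Rep T′ v F → size T ≡ size T′ → T ≡ T′
  Rep-unique-tree leaf       leaf         _ _ _ = refl
  Rep-unique-tree (node L R) (node L′ R′) {v} {F} (F₁ , repL , repR) (F₁′ , repL′ , repR′) eq
    with sizes ← +-cancelˡ-≡ v (size L) (size L′) (suc-injective (trans (sym F₁) F₁′))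
    with refl ← Rep-unique-tree L L′ repL repL′ sizes
    = cong (node L) (Rep-unique-tree R R′ repR repR′ (+-cancelˡ-≡ (size L) (size R) (size R′) (suc-injective eq)))

  Rep-unique-word : ∀ T {v F G} → Rep T v F → Rep T v G → ∀ i → i < size T → F (suc i) ≡ G (suc i)
  Rep-unique-word (node L R) (F₁ , _ , _) (G₁ , _ , _) zero _ = trans F₁ (sym G₁)
  Rep-unique-word (node L R) (_ , repL , repR) (_ , repL′ , repR′) (suc i) (s≤s i<) with split (size L) (size R) i i<
  ... | left i<l    = Rep-unique-word L repL repL′ i i<l
  ... | right k k<r = Rep-unique-word R repR repR′ k k<r

  letter : Tree → ℕ → ℕ → ℕ
  letter leaf       v i       = 0
  letter (node L R) v zero    = suc (v + size L)
  letter (node L R) v (suc i) with i <? size L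
  ... | yes _ = letter L v i
  ... | no  _ = letter R (suc (v + size L)) (i ∸ size L)

  letter-Rep : ∀ T {v F} → (∀ i → i < size T → F (suc i) ≡ letter T v i) → Rep T v F
  letter-Rep leaf       eq = tt
  letter-Rep (node L R) {v} {F} eq = eq 0 (s≤s z≤n) , letter-Rep L left-eq , letter-Rep R right-eq
    where
    left-eq : ∀ i → i < size L → F (suc (suc i)) ≡ letter L v i
    left-eq i i<l with eq (suc i) (s≤s (≤-trans i<l (m≤m+n _ _)))
    ... | e with i <? size L
    ...   | yes _ = e
    ...   | no ≮l = contradiction i<l ≮l
    right-eq : ∀ i → i < size R → F (suc (suc (i + size L))) ≡ letter R (suc (v + size L)) i
    right-eq i i<r with eq (suc (i + size L)) (s≤s (≤-trans (+-monoˡ-< (size L) i<r) (≤-reflexive (+-comm (size R) (size L)))))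
    ... | e with (i + size L) <? size L
    ...   | yes <l = contradiction <l (m+n≮n i (size L))
    ...   | no _ rewrite m+n∸n≡m i (size L) = e

  -- Bounds together with injectivity express an arrangement of v+1 ... v+m in a form that passes
  -- directly to both factors.
  record Is231Avoider (v m : ℕ) (F : ℕ → ℕ) : Set where
    field
      bounds    : ∀ i → i < m → v < F (suc i) × F (suc i) ≤ v + m
      injective : ∀ i j → i < j → j < m → F (suc i) ≢ F (suc j)
      avoids    : ∀ i j k → i < j → j < k → k < m → F (suc k) < F (suc i) → F (suc i) < F (suc j) → ⊥

  pigeonhole : ∀ v k p (G : ℕ → ℕ) → (∀ i → i < p → v < G i × G i ≤ v + k) →
    (∀ i j → i < j → j < p → G i ≢ G j) → p ≤ k
  pigeonhole v k p G bounds inj = Fin.injective⇒≤ {f = f} f-injective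
    where
    b : ∀ (i : Fin p) → v < G (toℕ i) × G (toℕ i) ≤ v + k
    b i = bounds (toℕ i) (Fin.toℕ<n i)
    small : ∀ i → G (toℕ i) ∸ suc v < k
    small i = ≤-trans (≤-reflexive (sym (+-∸-assoc 1 (proj₁ (b i))))) (≤-trans (∸-monoˡ-≤ v (proj₂ (b i))) (≤-reflexive (m+n∸m≡n v k)))
    f : Fin p → Fin k
    f i = fromℕ< (small i)
    G-eq : ∀ i j → f i ≡ f j → G (toℕ i) ≡ G (toℕ j)
    G-eq i j eq = ∸-cancelʳ-≡ (proj₁ (b i)) (proj₁ (b j))
      (trans (sym (Fin.toℕ-fromℕ< (small i))) (trans (cong toℕ eq) (Fin.toℕ-fromℕ< (small j))))
    f-injective : ∀ {i j} → f i ≡ f j → i ≡ j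
    f-injective {i} {j} eq with <-cmp (toℕ i) (toℕ j)
    ... | tri< i<j _ _ = contradiction (G-eq i j eq) (inj _ _ i<j (Fin.toℕ<n j))
    ... | tri≈ _ i≡j _ = Fin.toℕ-injective i≡j
    ... | tri> _ _ j<i = contradiction (sym (G-eq i j eq)) (inj _ _ j<i (Fin.toℕ<n i))

  -- The second hypothesis is avoidance of 231 with `a` as its first letter: nothing above `a` is
  -- followed by anything below it. So the letters below `a` form a prefix.
  threshold : ∀ a m (G : ℕ → ℕ) → (∀ i → i < m → G i ≢ a) →
    (∀ i j → i < j → j < m → a < G i → G j < a → ⊥) →
    ∃₂ λ p r → p + r ≡ m × (∀ i → i < p → G i < a) × (∀ j → j < r → a < G (j + p))
  threshold a zero    G ≢a mono = 0 , 0 , refl , (λ _ ()) , (λ _ ())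
  threshold a (suc m) G ≢a mono with <-cmp (G 0) a
  ... | tri≈ _ G₀≡a _ = contradiction G₀≡a (≢a 0 (s≤s z≤n))
  ... | tri> _ _ a<G₀ = 0 , suc m , refl , (λ _ ()) , high
    where
    high : ∀ j → j < suc m → a < G (j + 0)
    high zero    _    = a<G₀
    high (suc j) j<m rewrite +-identityʳ j with <-cmp (G (suc j)) a
    ... | tri< Gj<a _ _ = ⊥-elim (mono 0 (suc j) (s≤s z≤n) j<m a<G₀ Gj<a)
    ... | tri≈ _ eq _   = contradiction eq (≢a (suc j) j<m)
    ... | tri> _ _ a<Gj = a<Gj
  ... | tri< G₀<a _ _
    with p , r , refl , low , high ← threshold a m (G ∘ suc) (λ i i<m → ≢a (suc i) (s≤s i<m))
           (λ i j i<j j<m → mono (suc i) (suc j) (s≤s i<j) (s≤s j<m))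
    = suc p , r , refl , low′ , λ j j<r → subst (λ k → a < G k) (sym (+-suc j p)) (high j j<r)
    where
    low′ : ∀ i → i < suc p → G i < a
    low′ zero    _         = G₀<a
    low′ (suc i) (s≤s i<p) = low i i<p

  private
    sizes-agree : ∀ {p r l k} → p + r ≡ l + k → p ≤ l → r ≤ k → p ≡ l
    sizes-agree {p} {r} {l} {k} eq p≤l r≤k = ≤-antisym p≤l
      (+-cancelʳ-≤ k l p (≤-trans (≤-reflexive (sym eq)) (+-monoʳ-≤ p r≤k)))

  -- The crux is that the prefix of small letters has length F 1 - v - 1, called `l`. Its p letters
  -- take values among `l`, the other r among the remaining `k`, and p + r = l + k, so both
  -- pigeonhole bounds are equalities. The bound `d` supports the recursion into both factors.
  decompose : ∀ d m v F → m ≤ d → Is231Avoider v m F → ∃ λ T → size T ≡ m × Rep T v F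
  decompose d       zero    v F _ _ = leaf , refl , tt
  decompose (suc d) (suc m) v F (s≤s m≤d) av
    with p , r , refl , low , high ← threshold (F 1) m (λ i → F (suc (suc i)))
           (λ i i<m → (Is231Avoider.injective av 0 (suc i) (s≤s z≤n) (s≤s i<m)) ∘ sym)
           (λ i j i<j j<m a<Fi Fj<a → Is231Avoider.avoids av 0 (suc i) (suc j) (s≤s z≤n) (s≤s i<j) (s≤s j<m) Fj<a a<Fi)
    = assemble (decompose d p v (F ∘ suc) (≤-trans (m≤m+n p r) m≤d) av-left)
               (decompose d r (suc (v + p)) (λ i → F (suc (i + p))) (≤-trans (m≤n+m r p) m≤d) av-right)
    where
    open Is231Avoider av
    left< : ∀ {i} → i < p → suc i < suc (p + r)
    left< i<p = s≤s (≤-trans i<p (m≤m+n p r))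
    right< : ∀ {j} → j < r → suc (j + p) < suc (p + r)
    right< {j} j<r = s≤s (≤-trans (+-monoˡ-< p j<r) (≤-reflexive (+-comm r p)))
    l = F 1 ∸ suc v
    v<F₁ = proj₁ (bounds 0 (s≤s z≤n))
    F₁≡ : F 1 ≡ suc (v + l)
    F₁≡ = sym (m+[n∸m]≡n v<F₁)
    l≤p+r : l ≤ p + r
    l≤p+r = +-cancelˡ-≤ v l (p + r) (s≤s⁻¹ (≤-trans (≤-reflexive (sym F₁≡)) (≤-trans (proj₂ (bounds 0 (s≤s z≤n))) (≤-reflexive (+-suc v (p + r))))))
    k = p + r ∸ l
    l+k : l + k ≡ p + r
    l+k = m+[n∸m]≡n l≤p+r
    top : v + suc (p + r) ≡ suc (v + l) + k
    top = trans (+-suc v (p + r)) (cong suc (trans (cong (v +_) (sym l+k)) (sym (+-assoc v l k))))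
    p≡l : p ≡ l
    p≡l = sizes-agree {r = r} {k = k} (sym l+k)
      (pigeonhole v l p (λ i → F (suc (suc i)))
        (λ i i<p → proj₁ (bounds (suc i) (left< i<p)) , s≤s⁻¹ (≤-trans (low i i<p) (≤-reflexive F₁≡)))
        (λ i j i<j j<p → injective (suc i) (suc j) (s≤s i<j) (left< j<p)))
      (pigeonhole (suc (v + l)) k r (λ j → F (suc (suc (j + p))))
        (λ j j<r → ≤-trans (s≤s (≤-reflexive (sym F₁≡))) (high j j<r) , ≤-trans (proj₂ (bounds (suc (j + p)) (right< j<r))) (≤-reflexive top))
        (λ i j i<j j<r → injective (suc (i + p)) (suc (j + p)) (s≤s (+-monoˡ-< p i<j)) (right< j<r)))
    F₁≡p : F 1 ≡ suc (v + p)
    F₁≡p = trans F₁≡ (cong (λ x → suc (v + x)) (sym p≡l))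
    av-left : Is231Avoider v p (F ∘ suc)
    av-left = record
      { bounds    = λ i i<p → proj₁ (bounds (suc i) (left< i<p)) , s≤s⁻¹ (≤-trans (low i i<p) (≤-reflexive F₁≡p))
      ; injective = λ i j i<j j<p → injective (suc i) (suc j) (s≤s i<j) (left< j<p)
      ; avoids    = λ i j k i<j j<k k<p → avoids (suc i) (suc j) (suc k) (s≤s i<j) (s≤s j<k) (left< k<p)
      }
    av-right : Is231Avoider (suc (v + p)) r (λ i → F (suc (i + p)))
    av-right = record
      { bounds    = λ j j<r → ≤-trans (s≤s (≤-reflexive (sym F₁≡p))) (high j j<r) ,
          ≤-trans (proj₂ (bounds (suc (j + p)) (right< j<r))) (≤-reflexive (trans (+-suc v (p + r)) (cong suc (sym (+-assoc v p r)))))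
      ; injective = λ i j i<j j<r → injective (suc (i + p)) (suc (j + p)) (s≤s (+-monoˡ-< p i<j)) (right< j<r)
      ; avoids    = λ i j k i<j j<k k<r → avoids (suc (i + p)) (suc (j + p)) (suc (k + p)) (s≤s (+-monoˡ-< p i<j)) (s≤s (+-monoˡ-< p j<k)) (right< k<r)
      }
    assemble : (∃ λ T → size T ≡ p × Rep T v (F ∘ suc)) → (∃ λ T → size T ≡ r × Rep T (suc (v + p)) (λ i → F (suc (i + p)))) →
      ∃ λ T → size T ≡ suc (p + r) × Rep T v F
    assemble (L , refl , repL) (R , sizeR , repR) = node L R , cong (λ x → suc (size L + x)) sizeR , F₁≡p , repL , repR

  -- Indicator sums and the tree recursion of the statistics

  ⟦_⟧ : Bool → ℕ
  ⟦ true ⟧  = 1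
  ⟦ false ⟧ = 0

  <⇒<ᵇ≡true : ∀ {x y} → x < y → (x <ᵇ y) ≡ true
  <⇒<ᵇ≡true {x} {y} = dec-true (x <? y)

  ≤⇒<ᵇ≡false : ∀ {x y} → y ≤ x → (x <ᵇ y) ≡ false
  ≤⇒<ᵇ≡false {x} {y} y≤x = dec-false (x <? y) (≤⇒≯ y≤x)

  ∑< : ℕ → (ℕ → ℕ) → ℕ
  ∑< n h = sum {n} (h ∘ toℕ)

  ∑<-cong : ∀ n {g h} → (∀ i → i < n → g i ≡ h i) → ∑< n g ≡ ∑< n h
  ∑<-cong n eq = sum-cong-≗ {n} (λ i → eq (toℕ i) (Fin.toℕ<n i))

  ∑<-split : ∀ l r h → ∑< (l + r) h ≡ ∑< l h + ∑< r (λ j → h (j + l))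
  ∑<-split zero    r h = ∑<-cong r (λ i _ → cong h (sym (+-identityʳ i)))
  ∑<-split (suc l) r h = trans (cong (h 0 +_) (trans (∑<-split l r (h ∘ suc)) (cong (∑< l (h ∘ suc) +_) (∑<-cong r λ i _ → cong h (sym (+-suc i l))))))
    (sym (+-assoc (h 0) _ _))

  ∑<-zero : ∀ n h → (∀ i → i < n → h i ≡ 0) → ∑< n h ≡ 0
  ∑<-zero n h eq = trans (∑<-cong n eq) (sum-replicate-zero n)

  ∑<-one : ∀ n h → (∀ i → i < n → h i ≡ 1) → ∑< n h ≡ n
  ∑<-one n h eq = trans (∑<-cong n eq) (ones n)
    where
    ones : ∀ n → ∑< n (λ _ → 1) ≡ n
    ones zero    = refl
    ones (suc n) = cong suc (ones n)

  -- Statistics of F 0 … F m that are sums of contributions row F′ m′ of the steps from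
  -- F′ 0 to F′ 1, where F′ is a shift of F and m′ letters come later.
  Row : Set
  Row = (ℕ → ℕ) → ℕ → ℕ

  rowSum : Row → (ℕ → ℕ) → ℕ → ℕ
  rowSum row F zero    = 0
  rowSum row F (suc m) = row F m + rowSum row (F ∘ suc) m

  -- `F 0` is the preceding letter, `F 1` the first letter of a factor, then come its `l` small and
  -- `r` large letters. `row-local` discards later letters larger than both ends of the step; the
  -- last two fields evaluate the step in each context.
  record TreeRow (row : Row) (s : Context → ℕ → ℕ → ℕ) : Set where
    field
      row-cong  : ∀ {F G} m → (∀ i → F i ≡ G i) → row F m ≡ row G m
      row-local : ∀ F p r → (∀ j → j < r → F 0 < F (2 + (j + p)) × F 1 < F (2 + (j + p))) → row F (p + r) ≡ row F p
      row-above : ∀ F l r → F 1 < F 0 → (∀ i → i < l → F (2 + i) < F 1) →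
        (∀ j → j < r → F 1 < F (2 + (j + l)) × F (2 + (j + l)) < F 0) → row F (l + r) ≡ s above l r
      row-below : ∀ F l r → F 0 < F 1 → (∀ i → i < l → F 0 < F (2 + i) × F (2 + i) < F 1) →
        (∀ j → j < r → F 1 < F (2 + (j + l))) → row F (l + r) ≡ s below l r

  InContext : Context → ℕ → ℕ → ℕ → Set
  InContext above v m x = v + m < x
  InContext below v m x = x ≤ v

  module _ {row : Row} {s : Context → ℕ → ℕ → ℕ} (treeRow : TreeRow row s) where

    open TreeRow treeRow

    rowSum-cong : ∀ {F G} m → (∀ i → F i ≡ G i) → rowSum row F m ≡ rowSum row G m
    rowSum-cong zero    eq = refl
    rowSum-cong (suc m) eq = cong₂ _+_ (row-cong m eq) (rowSum-cong m (eq ∘ suc))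

    -- The letter at index `p` serves both sums, as the end of the first and the predecessor of the
    -- second. The second block exceeds everything before it, so `row-local` removes it from the
    -- earlier rows.
    rowSum-split : ∀ p r F → (∀ i j → i ≤ p → j < r → F i < F (suc (j + p))) →
      rowSum row F (p + r) ≡ rowSum row F p + rowSum row (λ i → F (i + p)) r
    rowSum-split zero    r F lt = rowSum-cong r (λ i → cong F (sym (+-identityʳ i)))
    rowSum-split (suc p) r F lt = begin
      row F (p + r) + rowSum row (F ∘ suc) (p + r)
        ≡⟨ cong₂ _+_ (row-local F p r λ j j<r → lt′ 0 j z≤n j<r , lt′ 1 j (s≤s z≤n) j<r)
                     (rowSum-split p r (F ∘ suc) (λ i j i≤p j<r → lt′ (suc i) j (s≤s i≤p) j<r)) ⟩
      row F p + (rowSum row (F ∘ suc) p + rowSum row (λ i → F (suc (i + p))) r)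
        ≡⟨ +-assoc (row F p) _ _ ⟨
      rowSum row F (suc p) + rowSum row (λ i → F (suc (i + p))) r
        ≡⟨ cong (rowSum row F (suc p) +_) (rowSum-cong r (λ i → cong F (sym (+-suc i p)))) ⟩
      rowSum row F (suc p) + rowSum row (λ i → F (i + suc p)) r ∎
      where
      open ≡-Reasoning
      lt′ : ∀ i j → i ≤ suc p → j < r → F i < F (2 + (j + p))
      lt′ i j i≤p j<r = subst (λ x → F i < F (suc x)) (+-suc j p) (lt i j i≤p j<r)

    -- The context evaluates the step into the root. The remaining steps split at the last letter of
    -- a L: the left factor is entered from a, above it, and the right factor from that last letter,
    -- below it.
    rowSum-tree : ∀ c T {v} F → Rep T v F → InContext c v (size T) (F 0) → rowSum row F (size T) ≡ treeStat s c T
    rowSum-node : ∀ L R {v} F → Rep (node L R) v F → rowSum row (F ∘ suc) (size L + size R) ≡ rootStat s (node L R)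

    rowSum-node L R {v} F rep@(F₁ , repL , repR) = trans
      (rowSum-split (size L) (size R) (F ∘ suc) (λ i j i≤l j<r → ≤-<-trans (Rep-prefix F rep i i≤l) (Rep-high F rep j j<r)))
      (cong₂ _+_ (rowSum-tree above L (F ∘ suc) repL (≤-reflexive (sym F₁)))
                 (rowSum-tree below R (λ i → F (suc (i + size L))) repR (≤-trans (Rep-prefix F rep (size L) ≤-refl) (≤-reflexive F₁))))

    rowSum-tree c     leaf       F rep ctx = refl
    rowSum-tree above (node L R) {v} F rep ctx = cong₂ _+_
      (row-above F (size L) (size R) (below-F₀ 0 (s≤s z≤n)) (Rep-low F rep)
        (λ j j<r → Rep-high F rep j j<r , below-F₀ (suc (j + size L)) (s≤s (≤-trans (+-monoˡ-< (size L) j<r) (≤-reflexive (+-comm (size R) (size L)))))))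
      (rowSum-node L R F rep)
      where
      below-F₀ : ∀ i → i < size (node L R) → F (suc i) < F 0
      below-F₀ i i< = ≤-<-trans (proj₂ (Rep-bounds (node L R) {v} {F} rep i i<)) ctx
    rowSum-tree below (node L R) {v} F rep ctx = cong₂ _+_
      (row-below F (size L) (size R) (above-F₀ 0 (s≤s z≤n))
        (λ i i<l → above-F₀ (suc i) (s≤s (≤-trans i<l (m≤m+n _ _))) , Rep-low F rep i i<l)
        (Rep-high F rep))
      (rowSum-node L R F rep)
      where
      above-F₀ : ∀ i → i < size (node L R) → F 0 < F (suc i)
      above-F₀ i i< = ≤-<-trans ctx (proj₁ (Rep-bounds (node L R) {v} {F} rep i i<))

    rowSum-root : ∀ T F → Rep T 0 F → rowSum row (F ∘ suc) (ℕ.pred (size T)) ≡ rootStat s T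
    rowSum-root leaf       F rep = refl
    rowSum-root (node L R) F rep = rowSum-node L R F rep

  between : ℕ → ℕ → ℕ → ℕ
  between x y z = ⟦ (x <ᵇ z) ∧ (z <ᵇ y) ⟧

  between-1 : ∀ {x y z} → x < z → z < y → between x y z ≡ 1
  between-1 x<z z<y rewrite <⇒<ᵇ≡true x<z | <⇒<ᵇ≡true z<y = refl

  between-0ˡ : ∀ {x y z} → z < x → between x y z ≡ 0
  between-0ˡ z<x rewrite ≤⇒<ᵇ≡false (<⇒≤ z<x) = refl

  between-0ʳ : ∀ {x y z} → y < z → between x y z ≡ 0
  between-0ʳ {x} {y} {z} y<z rewrite ≤⇒<ᵇ≡false (<⇒≤ y<z) | ∧-zeroʳ (x <ᵇ z) = refl

  desRow ascRow 13-2Row 31-2Row : Row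
  desRow  F m = ⟦ F 1 <ᵇ F 0 ⟧
  ascRow  F m = ⟦ F 0 <ᵇ F 1 ⟧
  13-2Row F m = ∑< m λ j → between (F 0) (F 1) (F (2 + j))
  31-2Row F m = ∑< m λ j → between (F 1) (F 0) (F (2 + j))

  desRow-tree : TreeRow desRow desᶜ
  desRow-tree = record
    { row-cong  = λ _ eq → cong₂ (λ x y → ⟦ x <ᵇ y ⟧) (eq 1) (eq 0)
    ; row-local = λ _ _ _ _ → refl
    ; row-above = λ _ _ _ lt _ _ → cong ⟦_⟧ (<⇒<ᵇ≡true lt)
    ; row-below = λ _ _ _ lt _ _ → cong ⟦_⟧ (≤⇒<ᵇ≡false (<⇒≤ lt))
    }

  ascRow-tree : TreeRow ascRow ascᶜ
  ascRow-tree = record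
    { row-cong  = λ _ eq → cong₂ (λ x y → ⟦ x <ᵇ y ⟧) (eq 0) (eq 1)
    ; row-local = λ _ _ _ _ → refl
    ; row-above = λ _ _ _ lt _ _ → cong ⟦_⟧ (≤⇒<ᵇ≡false (<⇒≤ lt))
    ; row-below = λ _ _ _ lt _ _ → cong ⟦_⟧ (<⇒<ᵇ≡true lt)
    }

  module _ (x y : ℕ) (G : ℕ → ℕ) where

    private
      count-between : (ℕ → ℕ) → ℕ → ℕ
      count-between H m = ∑< m (λ j → between x y (H j))

    ∑-between-split : ∀ l r {a b} → count-between G l ≡ a → count-between (λ j → G (j + l)) r ≡ b →
      count-between G (l + r) ≡ a + b
    ∑-between-split l r p q = trans (∑<-split l r (λ j → between x y (G j))) (cong₂ _+_ p q)

    ∑-between-all : ∀ m → (∀ j → j < m → x < G j × G j < y) → count-between G m ≡ m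
    ∑-between-all m lt = ∑<-one m (λ j → between x y (G j)) (λ j j<m → between-1 (proj₁ (lt j j<m)) (proj₂ (lt j j<m)))

    ∑-between-low : ∀ m → (∀ j → j < m → G j < x) → count-between G m ≡ 0
    ∑-between-low m lt = ∑<-zero m (λ j → between x y (G j)) (λ j j<m → between-0ˡ {x} {y} (lt j j<m))

    ∑-between-high : ∀ m → (∀ j → j < m → y < G j) → count-between G m ≡ 0
    ∑-between-high m lt = ∑<-zero m (λ j → between x y (G j)) (λ j j<m → between-0ʳ {x} {y} (lt j j<m))

  private
    between-cong : ∀ {x x′ y y′ z z′} → x ≡ x′ → y ≡ y′ → z ≡ z′ → between x y z ≡ between x′ y′ z′
    between-cong refl refl refl = refl

  13-2Row-tree : TreeRow 13-2Row 13-2ᶜ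
  13-2Row-tree = record
    { row-cong  = λ m eq → ∑<-cong m λ j _ → between-cong (eq 0) (eq 1) (eq (2 + j))
    ; row-local = λ F p r lt → trans
        (∑-between-split (F 0) (F 1) (λ j → F (2 + j)) p r refl
          (∑-between-high (F 0) (F 1) (λ j → F (2 + (j + p))) r λ j j<r → proj₂ (lt j j<r)))
        (+-identityʳ _)
    ; row-above = λ F l r lt low high → ∑-between-split (F 0) (F 1) (λ j → F (2 + j)) l r
        (∑-between-low (F 0) (F 1) (λ j → F (2 + j)) l λ i i<l → <-trans (low i i<l) lt)
        (∑-between-high (F 0) (F 1) (λ j → F (2 + (j + l))) r λ j j<r → proj₁ (high j j<r))
    ; row-below = λ F l r lt low high → trans
        (∑-between-split (F 0) (F 1) (λ j → F (2 + j)) l r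
          (∑-between-all (F 0) (F 1) (λ j → F (2 + j)) l low)
          (∑-between-high (F 0) (F 1) (λ j → F (2 + (j + l))) r high))
        (+-identityʳ l)
    }

  31-2Row-tree : TreeRow 31-2Row 31-2ᶜ
  31-2Row-tree = record
    { row-cong  = λ m eq → ∑<-cong m λ j _ → between-cong (eq 1) (eq 0) (eq (2 + j))
    ; row-local = λ F p r lt → trans
        (∑-between-split (F 1) (F 0) (λ j → F (2 + j)) p r refl
          (∑-between-high (F 1) (F 0) (λ j → F (2 + (j + p))) r λ j j<r → proj₁ (lt j j<r)))
        (+-identityʳ _)
    ; row-above = λ F l r lt low high → ∑-between-split (F 1) (F 0) (λ j → F (2 + j)) l r
        (∑-between-low (F 1) (F 0) (λ j → F (2 + j)) l low)
        (∑-between-all (F 1) (F 0) (λ j → F (2 + (j + l))) r high)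
    ; row-below = λ F l r lt low high → ∑-between-split (F 1) (F 0) (λ j → F (2 + j)) l r
        (∑-between-high (F 1) (F 0) (λ j → F (2 + j)) l λ i i<l → proj₁ (low i i<l))
        (∑-between-high (F 1) (F 0) (λ j → F (2 + (j + l))) r λ j j<r → <-trans lt (high j j<r))
    }

  ⟨⟩-toℕ : ∀ {n} (π : Word n n) (i : Fin n) → π ⟨ suc (toℕ i) ⟩ ≡ suc (toℕ (lookup π i))
  ⟨⟩-toℕ {n} π i with toℕ i <? n
  ... | yes p = cong (suc ∘ toℕ ∘ lookup π) (Fin.fromℕ<-toℕ i p)
  ... | no ¬p = contradiction (Fin.toℕ<n i) ¬p

  ⟨⟩-fromℕ< : ∀ {n} (π : Word n n) {i} (i<n : i < n) → π ⟨ suc i ⟩ ≡ suc (toℕ (lookup π (fromℕ< i<n)))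
  ⟨⟩-fromℕ< π i<n = subst (λ k → π ⟨ suc k ⟩ ≡ suc (toℕ (lookup π (fromℕ< i<n)))) (Fin.toℕ-fromℕ< i<n) (⟨⟩-toℕ π (fromℕ< i<n))

  word-ext : ∀ {k n} {π ρ : Word k n} → (∀ i → lookup π i ≡ lookup ρ i) → π ≡ ρ
  word-ext {π = π} {ρ} eq = trans (sym (tabulate∘lookup π)) (trans (tabulate-cong eq) (tabulate∘lookup ρ))

  module _ {n} (π : Word n n) where

    ⟨⟩-bounds : ∀ i → i < n → 0 < π ⟨ suc i ⟩ × π ⟨ suc i ⟩ ≤ n
    ⟨⟩-bounds i i<n rewrite ⟨⟩-fromℕ< π i<n = s≤s z≤n , Fin.toℕ<n _

    ⟨⟩-injective : IsPermutation π → ∀ i j → i < j → j < n → π ⟨ suc i ⟩ ≢ π ⟨ suc j ⟩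
    ⟨⟩-injective (inj , _) i j i<j j<n eq = <⇒≢ i<j (Fin.fromℕ<-injective i j (<-trans i<j j<n) j<n
      (inj (Fin.toℕ-injective (suc-injective (trans (sym (⟨⟩-fromℕ< π (<-trans i<j j<n))) (trans eq (⟨⟩-fromℕ< π j<n)))))))

  -- Patterns of length three

  private
    SameOrder : ∀ {n} → Word 3 3 → Word n n → Word 3 n → Fin 3 → Fin 3 → Set
    SameOrder τ π ι a b =
      (lookup τ a Fin.< lookup τ b → lookup π (lookup ι a) Fin.< lookup π (lookup ι b)) ×
      (lookup π (lookup ι a) Fin.< lookup π (lookup ι b) → lookup τ a Fin.< lookup τ b)

    module _ {n} (τ : Word 3 3) (π : Word n n) (ι : Word 3 n) where

      -- For a concrete pattern the comparison in `τ` is decided by evaluation, so only the one in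
      -- `π` is supplied.
      both : ∀ a b {τ< : True (lookup τ a Fin.<? lookup τ b)} →
        lookup π (lookup ι a) Fin.< lookup π (lookup ι b) → SameOrder τ π ι a b
      both a b {τ<} lt = (λ _ → lt) , (λ _ → toWitness τ<)

      neither : ∀ a b {τ≮ : False (lookup τ a Fin.<? lookup τ b)} →
        ¬ lookup π (lookup ι a) Fin.< lookup π (lookup ι b) → SameOrder τ π ι a b
      neither a b {τ≮} ≮ = (λ τ< → contradiction τ< (toWitnessFalse τ≮)) , (λ lt → contradiction lt ≮)

    increasing₃ : ∀ {n} {i j k : Fin n} → i Fin.< j → j Fin.< k → ∀ a b → a Fin.< b →
      lookup (i ∷ j ∷ k ∷ []) a Fin.< lookup (i ∷ j ∷ k ∷ []) b
    increasing₃ i<j j<k 0F 1F _ = i<j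
    increasing₃ i<j j<k 0F 2F _ = <-trans i<j j<k
    increasing₃ i<j j<k 1F 2F _ = j<k
    increasing₃ i<j j<k 1F 1F (s≤s ())
    increasing₃ i<j j<k 2F 1F (s≤s ())
    increasing₃ i<j j<k 2F 2F (s≤s (s≤s ()))

  contains-231 : ∀ {n} {π : Word n n} {i j k} → i Fin.< j → j Fin.< k →
    lookup π k Fin.< lookup π i → lookup π i Fin.< lookup π j → Contains p231 π
  contains-231 {π = π} {i} {j} {k} i<j j<k k<i i<j′ = i ∷ j ∷ k ∷ [] , increasing₃ i<j j<k , order
    where
    ι = i ∷ j ∷ k ∷ []
    order : ∀ a b → SameOrder p231 π ι a b
    order 0F 0F = neither p231 π ι 0F 0F (Fin.<-irrefl refl)
    order 0F 1F = both p231 π ι 0F 1F i<j′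
    order 0F 2F = neither p231 π ι 0F 2F (<-asym k<i)
    order 1F 0F = neither p231 π ι 1F 0F (<-asym i<j′)
    order 1F 1F = neither p231 π ι 1F 1F (Fin.<-irrefl refl)
    order 1F 2F = neither p231 π ι 1F 2F (<-asym (<-trans k<i i<j′))
    order 2F 0F = both p231 π ι 2F 0F k<i
    order 2F 1F = both p231 π ι 2F 1F (<-trans k<i i<j′)
    order 2F 2F = neither p231 π ι 2F 2F (Fin.<-irrefl refl)

  contains-312 : ∀ {n} {π : Word n n} {i j k} → i Fin.< j → j Fin.< k →
    lookup π j Fin.< lookup π k → lookup π k Fin.< lookup π i → Contains p312 π
  contains-312 {π = π} {i} {j} {k} i<j j<k j<k′ k<i = i ∷ j ∷ k ∷ [] , increasing₃ i<j j<k , order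
    where
    ι = i ∷ j ∷ k ∷ []
    order : ∀ a b → SameOrder p312 π ι a b
    order 0F 0F = neither p312 π ι 0F 0F (Fin.<-irrefl refl)
    order 0F 1F = neither p312 π ι 0F 1F (<-asym (<-trans j<k′ k<i))
    order 0F 2F = neither p312 π ι 0F 2F (<-asym k<i)
    order 1F 0F = both p312 π ι 1F 0F (<-trans j<k′ k<i)
    order 1F 1F = neither p312 π ι 1F 1F (Fin.<-irrefl refl)
    order 1F 2F = both p312 π ι 1F 2F j<k′
    order 2F 0F = both p312 π ι 2F 0F k<i
    order 2F 1F = neither p312 π ι 2F 1F (<-asym j<k′)
    order 2F 2F = neither p312 π ι 2F 2F (Fin.<-irrefl refl)

  private
    ⟨⟩-< : ∀ {n} (π : Word n n) {i j} (i<n : i < n) (j<n : j < n) → π ⟨ suc i ⟩ < π ⟨ suc j ⟩ →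
      lookup π (fromℕ< i<n) Fin.< lookup π (fromℕ< j<n)
    ⟨⟩-< π i<n j<n lt = s≤s⁻¹ (subst₂ _<_ (⟨⟩-fromℕ< π i<n) (⟨⟩-fromℕ< π j<n) lt)

    fromℕ<-mono : ∀ {n i j} (i<n : i < n) (j<n : j < n) → i < j → fromℕ< i<n Fin.< fromℕ< j<n
    fromℕ<-mono i<n j<n i<j = subst₂ _<_ (sym (Fin.toℕ-fromℕ< i<n)) (sym (Fin.toℕ-fromℕ< j<n)) i<j

  module _ {n} {π : Word n n} where

    avoids-231 : Avoids p231 π → ∀ i j k → i < j → j < k → k < n →
      π ⟨ suc k ⟩ < π ⟨ suc i ⟩ → π ⟨ suc i ⟩ < π ⟨ suc j ⟩ → ⊥
    avoids-231 av i j k i<j j<k k<n k<i i<j′ = av (contains-231 {π = π} (fromℕ<-mono i<n j<n i<j) (fromℕ<-mono j<n k<n j<k)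
      (⟨⟩-< π k<n i<n k<i) (⟨⟩-< π i<n j<n i<j′))
      where
      j<n = <-trans j<k k<n
      i<n = <-trans i<j j<n

    avoids-312 : Avoids p312 π → ∀ i j k → i < j → j < k → k < n →
      π ⟨ suc j ⟩ < π ⟨ suc k ⟩ → π ⟨ suc k ⟩ < π ⟨ suc i ⟩ → ⊥
    avoids-312 av i j k i<j j<k k<n j<k′ k<i = av (contains-312 {π = π} (fromℕ<-mono i<n j<n i<j) (fromℕ<-mono j<n k<n j<k)
      (⟨⟩-< π j<n k<n j<k′) (⟨⟩-< π k<n i<n k<i))
      where
      j<n = <-trans j<k k<n
      i<n = <-trans i<j j<n

  -- 231-avoiding permutations and binary trees

  -- The reduction mod n is vacuous for the trees of size n.
  toWord : ∀ n → Tree → Word n n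
  toWord zero    T = []
  toWord (suc n) T = tabulate λ i → pred (letter T 0 (toℕ i)) mod suc n

  letter-bounds : ∀ T v i → i < size T → v < letter T v i × letter T v i ≤ v + size T
  letter-bounds T v = Rep-bounds T {v} {λ i → letter T v (pred i)} (letter-Rep T (λ _ _ → refl))

  toWord-letter : ∀ {n} T → size T ≡ n → ∀ i → i < n → toWord n T ⟨ suc i ⟩ ≡ letter T 0 i
  toWord-letter {suc n} T size≡ i i<n = begin
    toWord (suc n) T ⟨ suc i ⟩                  ≡⟨ ⟨⟩-fromℕ< (toWord (suc n) T) i<n ⟩
    suc (toℕ (lookup (toWord (suc n) T) k))     ≡⟨ cong (suc ∘ toℕ) (lookup∘tabulate (λ j → pred (letter T 0 (toℕ j)) mod suc n) k) ⟩
    suc (toℕ (pred (letter T 0 (toℕ k)) mod suc n))   ≡⟨ cong (λ x → suc (toℕ (pred (letter T 0 x) mod suc n))) (Fin.toℕ-fromℕ< i<n) ⟩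
    suc (toℕ (pred (letter T 0 i) mod suc n))   ≡⟨ cong suc (Fin.toℕ-fromℕ< (m%n<n (pred (letter T 0 i)) (suc n))) ⟩
    suc (pred (letter T 0 i) ℕ.% suc n)         ≡⟨ cong suc (m<n⇒m%n≡m pred<) ⟩
    suc (pred (letter T 0 i))                   ≡⟨ suc-pred (letter T 0 i) ⦃ ℕ.>-nonZero pos ⦄ ⟩
    letter T 0 i                                ∎
    where
    open ≡-Reasoning
    k = fromℕ< i<n
    bounds = letter-bounds T 0 i (subst (i <_) (sym size≡) i<n)
    pos = proj₁ bounds
    pred< : pred (letter T 0 i) < suc n
    pred< = ≤-trans (≤-reflexive (suc-pred (letter T 0 i) ⦃ ℕ.>-nonZero pos ⦄)) (subst (letter T 0 i ≤_) size≡ (proj₂ bounds))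

  toWord-Rep : ∀ {n} T → size T ≡ n → Rep T 0 (toWord n T ⟨_⟩)
  toWord-Rep T refl = letter-Rep T (toWord-letter T refl)

  Rep-permutation : ∀ T {π : Word (size T) (size T)} → Rep T 0 (π ⟨_⟩) → IsPermutation π
  Rep-permutation T {π} rep = inj , surj
    where
    inj : ∀ {i j} → lookup π i ≡ lookup π j → i ≡ j
    inj {i} {j} eq with <-cmp (toℕ i) (toℕ j) | trans (⟨⟩-toℕ π i) (trans (cong (suc ∘ toℕ) eq) (sym (⟨⟩-toℕ π j)))
    ... | tri< i<j _ _ | eq′ = contradiction eq′ (Rep-injective T rep _ _ i<j (Fin.toℕ<n j))
    ... | tri≈ _ i≡j _ | _   = Fin.toℕ-injective i≡j
    ... | tri> _ _ j<i | eq′ = contradiction (sym eq′) (Rep-injective T rep _ _ j<i (Fin.toℕ<n i))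
    surj : ∀ y → ∃ λ x → ∀ {z} → z ≡ x → lookup π z ≡ y
    surj y with i , i<n , eq ← Rep-surjective T rep (suc (toℕ y)) (s≤s z≤n) (Fin.toℕ<n y)
      = fromℕ< i<n , λ { refl → Fin.toℕ-injective (suc-injective (trans (sym (⟨⟩-fromℕ< π i<n)) eq)) }

  Rep-avoids-231 : ∀ T {π : Word (size T) (size T)} → Rep T 0 (π ⟨_⟩) → Avoids p231 π
  Rep-avoids-231 T {π} rep (i ∷ j ∷ k ∷ [] , increasing , order) =
    Rep-avoids T rep (toℕ i) (toℕ j) (toℕ k) (increasing 0F 1F (s≤s z≤n)) (increasing 1F 2F (s≤s (s≤s z≤n))) (Fin.toℕ<n k)
      (subst₂ _<_ (sym (⟨⟩-toℕ π k)) (sym (⟨⟩-toℕ π i)) (s≤s (proj₁ (order 2F 0F) (s≤s z≤n))))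
      (subst₂ _<_ (sym (⟨⟩-toℕ π i)) (sym (⟨⟩-toℕ π j)) (s≤s (proj₁ (order 0F 1F) (s≤s (s≤s z≤n)))))

  unique∧set⇒↭ : ∀ {a} {A : Set a} {xs ys : List A} → Unique xs → Unique ys →
    (∀ {x} → x ∈ xs → x ∈ ys) → (∀ {x} → x ∈ ys → x ∈ xs) → xs ↭ ys
  unique∧set⇒↭ xs! ys! to from = ∼bag⇒↭ (unique∧set⇒bag xs! ys! (mk⇔ to from))

  map-unique : ∀ {a b} {A : Set a} {B : Set b} (f : A → B) {xs} →
    (∀ {x y} → x ∈ xs → y ∈ xs → f x ≡ f y → x ≡ y) → Unique xs → Unique (map f xs)
  map-unique f inj []        = []
  map-unique f inj (x∉ ∷ xs!) =
    All.map⁺ (All.tabulate λ y∈ eq → All.lookup x∉ y∈ (inj (here refl) (there y∈) eq)) ∷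
    map-unique f (λ x∈ y∈ → inj (there x∈) (there y∈)) xs!

  -- `decompose` finds the tree of an avoider and `Rep-unique-word` recovers the avoider from it;
  -- `Rep-unique-tree` makes the encoding injective.
  𝔖-231-trees : ∀ n → 𝔖 n p231 ↭ map (toWord n) (trees n n)
  𝔖-231-trees n = unique∧set⇒↭ (𝔖-unique n p231)
    (map-unique (toWord n) toWord-injective (trees-unique n n)) to from
    where
    toWord-injective : ∀ {T T′} → T ∈ trees n n → T′ ∈ trees n n → toWord n T ≡ toWord n T′ → T ≡ T′
    toWord-injective {T} {T′} T∈ T′∈ eq = Rep-unique-tree T T′ (toWord-Rep T sT)
      (subst (λ π → Rep T′ 0 (π ⟨_⟩)) (sym eq) (toWord-Rep T′ sT′)) (trans sT (sym sT′))
      where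
      sT  = ∈-trees⁻ n n T∈
      sT′ = ∈-trees⁻ n n T′∈
    to : ∀ {π} → π ∈ 𝔖 n p231 → π ∈ map (toWord n) (trees n n)
    to {π} π∈ with perm , av ← Equivalence.to (∈-𝔖 p231 π) π∈
      with T , refl , rep ← decompose n n 0 (π ⟨_⟩) ≤-refl (record
             { bounds = ⟨⟩-bounds π ; injective = ⟨⟩-injective π perm ; avoids = avoids-231 {π = π} av })
      = subst (_∈ map (toWord n) (trees n n))
          (word-ext λ i → Fin.toℕ-injective (suc-injective (trans (sym (⟨⟩-toℕ (toWord n T) i))
            (trans (Rep-unique-word T (toWord-Rep T refl) rep (toℕ i) (Fin.toℕ<n i)) (⟨⟩-toℕ π i)))))
          (∈-map⁺ (toWord n) (∈-trees⁺ n T ≤-refl))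
    from : ∀ {π} → π ∈ map (toWord n) (trees n n) → π ∈ 𝔖 n p231
    from π∈ with T , T∈ , refl ← ∈-map⁻ (toWord n) π∈ with refl ← ∈-trees⁻ n n T∈
      = Equivalence.from (∈-𝔖 p231 (toWord n T)) (Rep-permutation T (toWord-Rep T refl) , Rep-avoids-231 T (toWord-Rep T refl))

  -- Complement and reverse-complement

  complement : ∀ {k n} → Word k n → Word k n
  complement π = tabulate λ i → opposite (lookup π i)

  reverseComplement : ∀ {k n} → Word k n → Word k n
  reverseComplement π = tabulate λ i → opposite (lookup π (opposite i))

  lookup-complement : ∀ {k n} (π : Word k n) i → lookup (complement π) i ≡ opposite (lookup π i)
  lookup-complement π = lookup∘tabulate λ i → opposite (lookup π i)

  lookup-reverseComplement : ∀ {k n} (π : Word k n) i → lookup (reverseComplement π) i ≡ opposite (lookup π (opposite i))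
  lookup-reverseComplement π = lookup∘tabulate λ i → opposite (lookup π (opposite i))

  opposite-injective : ∀ {n} {i j : Fin n} → opposite i ≡ opposite j → i ≡ j
  opposite-injective {i = i} {j} eq = trans (sym (Fin.opposite-involutive i)) (trans (cong opposite eq) (Fin.opposite-involutive j))

  opposite-mono : ∀ {n} {i j : Fin n} → i Fin.< j → opposite j Fin.< opposite i
  opposite-mono {n} {i} {j} i<j = subst₂ _<_ (sym (Fin.opposite-prop j)) (sym (Fin.opposite-prop i))
    (∸-monoʳ-< (s≤s i<j) (Fin.toℕ<n j))

  opposite-cancel : ∀ {n} {i j : Fin n} → opposite j Fin.< opposite i → i Fin.< j
  opposite-cancel {i = i} {j} lt = subst₂ Fin._<_ (Fin.opposite-involutive i) (Fin.opposite-involutive j) (opposite-mono lt)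

  -- `φ` acts on patterns and permutations alike. As it is an involution, preservation of
  -- containment yields preservation of avoidance and the bijection between the classes.
  record Symmetry (φ : ∀ {k} → Word k k → Word k k) : Set where
    field
      involutive  : ∀ {k} (π : Word k k) → φ (φ π) ≡ π
      permutation : ∀ {n} {π : Word n n} → IsPermutation π → IsPermutation (φ π)
      contains    : ∀ {k n} {τ : Word k k} {π : Word n n} → Contains τ π → Contains (φ τ) (φ π)

    avoids : ∀ {k n} {τ : Word k k} {π : Word n n} → Avoids τ π → Avoids (φ τ) (φ π)
    avoids {τ = τ} {π} av c = av (subst₂ Contains (involutive τ) (involutive π) (contains c))

    𝔖-symmetric : ∀ {k} n (τ : Word k k) → 𝔖 n (φ τ) ↭ map φ (𝔖 n τ)
    𝔖-symmetric n τ = unique∧set⇒↭ (𝔖-unique n (φ τ)) (Unique.map⁺ φ-injective (𝔖-unique n τ)) to from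
      where
      φ-injective : ∀ {π ρ} → φ π ≡ φ ρ → π ≡ ρ
      φ-injective {π} {ρ} eq = trans (sym (involutive π)) (trans (cong φ eq) (involutive ρ))
      to : ∀ {π} → π ∈ 𝔖 n (φ τ) → π ∈ map φ (𝔖 n τ)
      to {π} π∈ with perm , av ← Equivalence.to (∈-𝔖 (φ τ) π) π∈ =
        subst (_∈ map φ (𝔖 n τ)) (involutive π) (∈-map⁺ φ (Equivalence.from (∈-𝔖 τ (φ π))
          (permutation perm , subst (λ σ → Avoids σ (φ π)) (involutive τ) (avoids {τ = φ τ} av))))
      from : ∀ {π} → π ∈ map φ (𝔖 n τ) → π ∈ 𝔖 n (φ τ)
      from π∈ with ρ , ρ∈ , refl ← ∈-map⁻ φ π∈ with perm , av ← Equivalence.to (∈-𝔖 τ ρ) ρ∈ =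
        Equivalence.from (∈-𝔖 (φ τ) (φ ρ)) (permutation perm , avoids {τ = τ} av)

  complement-symmetry : Symmetry complement
  complement-symmetry = record
    { involutive  = λ π → word-ext λ i → trans (lookup-complement (complement π) i)
        (trans (cong opposite (lookup-complement π i)) (Fin.opposite-involutive _))
    ; permutation = λ {_} {π} (inj , surj) →
        (λ {i} {j} eq → inj (opposite-injective (trans (sym (lookup-complement π i)) (trans eq (lookup-complement π j))))) ,
        (λ y → let x , f = surj (opposite y) in
          x , λ {z} z≡x → trans (lookup-complement π z) (trans (cong opposite (f z≡x)) (Fin.opposite-involutive y)))
    ; contains    = λ {_} {_} {τ} {π} (ι , increasing , order) → ι , increasing , λ a b →
        (λ lt → anti π (proj₁ (order b a) (unanti τ lt))) , (λ lt → anti τ (proj₂ (order b a) (unanti π lt)))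
    }
    where
    anti : ∀ {k} (π : Word k k) {a b} → lookup π b Fin.< lookup π a → lookup (complement π) a Fin.< lookup (complement π) b
    anti π {a} {b} lt = subst₂ Fin._<_ (sym (lookup-complement π a)) (sym (lookup-complement π b)) (opposite-mono lt)
    unanti : ∀ {k} (π : Word k k) {a b} → lookup (complement π) a Fin.< lookup (complement π) b → lookup π b Fin.< lookup π a
    unanti π {a} {b} lt = opposite-cancel (subst₂ Fin._<_ (lookup-complement π a) (lookup-complement π b) lt)

  reverseComplement-symmetry : Symmetry reverseComplement
  reverseComplement-symmetry = record
    { involutive  = λ π → word-ext λ i → trans (lookup-rc (reverseComplement π) i)
        (trans (cong opposite (lookup-rc π (opposite i)))
          (trans (Fin.opposite-involutive _) (cong (lookup π) (Fin.opposite-involutive i))))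
    ; permutation = λ {_} {π} (inj , surj) →
        (λ {i} {j} eq → opposite-injective (inj (opposite-injective (trans (sym (lookup-rc π i)) (trans eq (lookup-rc π j)))))) ,
        (λ y → let x , f = surj (opposite y) in
          opposite x , λ { refl → trans (lookup-rc π (opposite x))
            (trans (cong opposite (f (Fin.opposite-involutive x))) (Fin.opposite-involutive y)) })
    -- The occurrence sits at the mirrored positions, listed backwards to stay increasing:
    -- `reverseComplement` applied to `ι` itself.
    ; contains    = λ {_} {_} {τ} {π} (ι , increasing , order) → reverseComplement ι ,
        (λ a b a<b → subst₂ Fin._<_ (sym (lookup-rc ι a)) (sym (lookup-rc ι b)) (opposite-mono (increasing _ _ (opposite-mono a<b)))) ,
        (λ a b → (λ lt → anti π ι (proj₁ (order (opposite b) (opposite a)) (opposite-cancel (subst₂ Fin._<_ (lookup-rc τ a) (lookup-rc τ b) lt)))) ,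
                 (λ lt → subst₂ Fin._<_ (sym (lookup-rc τ a)) (sym (lookup-rc τ b)) (opposite-mono (proj₂ (order (opposite b) (opposite a)) (unanti π ι lt)))))
    }
    where
    lookup-rc : ∀ {k n} (π : Word k n) i → lookup (reverseComplement π) i ≡ opposite (lookup π (opposite i))
    lookup-rc = lookup-reverseComplement
    lookup-rc² : ∀ {k n} (π : Word n n) (ι : Word k n) a →
      lookup (reverseComplement π) (lookup (reverseComplement ι) a) ≡ opposite (lookup π (lookup ι (opposite a)))
    lookup-rc² π ι a = trans (lookup-rc π _) (cong (opposite ∘ lookup π) (trans (cong opposite (lookup-rc ι a)) (Fin.opposite-involutive _)))
    anti : ∀ {k n} (π : Word n n) (ι : Word k n) {a b} → lookup π (lookup ι (opposite b)) Fin.< lookup π (lookup ι (opposite a)) →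
      lookup (reverseComplement π) (lookup (reverseComplement ι) a) Fin.< lookup (reverseComplement π) (lookup (reverseComplement ι) b)
    anti π ι {a} {b} lt = subst₂ Fin._<_ (sym (lookup-rc² π ι a)) (sym (lookup-rc² π ι b)) (opposite-mono lt)
    unanti : ∀ {k n} (π : Word n n) (ι : Word k n) {a b} →
      lookup (reverseComplement π) (lookup (reverseComplement ι) a) Fin.< lookup (reverseComplement π) (lookup (reverseComplement ι) b) →
      lookup π (lookup ι (opposite b)) Fin.< lookup π (lookup ι (opposite a))
    unanti π ι {a} {b} lt = opposite-cancel (subst₂ Fin._<_ (lookup-rc² π ι a) (lookup-rc² π ι b) lt)

  -- Statistics as sums

  length-filter-map : ∀ {a b p} {A : Set a} {B : Set b} {P : B → Set p} (P? : ∀ x → Dec (P x)) (f : A → B) xs →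
    length (filter P? (map f xs)) ≡ length (filter (P? ∘ f) xs)
  length-filter-map P? f []       = refl
  length-filter-map P? f (x ∷ xs) with does (P? (f x))
  ... | true  = cong suc (length-filter-map P? f xs)
  ... | false = length-filter-map P? f xs

  length-filter-applyUpTo : ∀ {p} {P : ℕ → Set p} (P? : ∀ i → Dec (P i)) f n →
    length (filter P? (applyUpTo f n)) ≡ ∑< n (λ i → ⟦ does (P? (f i)) ⟧)
  length-filter-applyUpTo P? f zero    = refl
  length-filter-applyUpTo P? f (suc n) with does (P? (f 0))
  ... | true  = cong suc (length-filter-applyUpTo P? (f ∘ suc) n)
  ... | false = length-filter-applyUpTo P? (f ∘ suc) n

  count≡∑ : ∀ n {P : ℕ → Set} (P? : ∀ i → Dec (P i)) → count n P? ≡ ∑< n (λ i → ⟦ does (P? (suc i)) ⟧)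
  count≡∑ n P? = trans (length-filter-map P? suc (upTo n)) (length-filter-applyUpTo (P? ∘ suc) id n)

  length-filter-product : ∀ {a p} {A : Set a} {P : ℕ × A → Set p} (P? : ∀ x → Dec (P x)) f n (ys : List A) →
    length (filter P? (cartesianProduct (map suc (applyUpTo f n)) ys)) ≡ ∑< n (λ i → length (filter (λ y → P? (suc (f i) , y)) ys))
  length-filter-product P? f zero    ys = refl
  length-filter-product P? f (suc n) ys = begin
    length (filter P? (map (suc (f 0) ,_) ys ++ rest))                           ≡⟨ cong length (filter-++ P? (map (suc (f 0) ,_) ys) rest) ⟩
    length (filter P? (map (suc (f 0) ,_) ys) ++ filter P? rest)                 ≡⟨ length-++ (filter P? (map (suc (f 0) ,_) ys)) ⟩
    length (filter P? (map (suc (f 0) ,_) ys)) + length (filter P? rest)         ≡⟨ cong₂ _+_ (length-filter-map P? _ ys) (length-filter-product P? (f ∘ suc) n ys) ⟩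
    ∑< (suc n) (λ i → length (filter (λ y → P? (suc (f i) , y)) ys)) ∎
    where
    open ≡-Reasoning
    rest = cartesianProduct (map suc (applyUpTo (f ∘ suc) n)) ys

  countPairs≡∑ : ∀ n {P : ℕ → ℕ → Set} (P? : ∀ i j → Dec (P i j)) →
    countPairs n P? ≡ ∑< n (λ i → ∑< n (λ j → ⟦ does (P? (suc i) (suc j)) ⟧))
  countPairs≡∑ n P? = trans (length-filter-product (λ (i , j) → P? i j) id n [1… n ]) (∑<-cong n λ i _ → count≡∑ n (P? (suc i)))

  -- Cells with `j` at most `suc i` evaluate to zero, so the square of pairs reduces by computation
  -- to a staircase, with one row for each step.
  ∑-pairs≡rowSum : ∀ (b : ℕ → ℕ → ℕ → Bool) n F →
    ∑< n (λ i → ∑< n (λ j → ⟦ (suc i <ᵇ j) ∧ b (F i) (F (suc i)) (F j) ⟧)) ≡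
    rowSum (λ G m → ∑< m (λ j → ⟦ b (G 0) (G 1) (G (2 + j)) ⟧)) F (pred n)
  ∑-pairs≡rowSum b zero          F = refl
  ∑-pairs≡rowSum b (suc zero)    F = refl
  ∑-pairs≡rowSum b (suc (suc m)) F = cong (∑< m (λ j → ⟦ b (F 0) (F 1) (F (2 + j)) ⟧) +_) (∑-pairs≡rowSum b (suc m) (F ∘ suc))

  module _ {n} (π : Word n n) where

    private
      F : ℕ → ℕ
      F i = π ⟨ suc i ⟩

    des≡rowSum : des π ≡ rowSum desRow F (pred n)
    des≡rowSum = trans (count≡∑ (n ∸ 1) (λ i → π ⟨ suc i ⟩ <? π ⟨ i ⟩)) (∑≡rowSum (n ∸ 1) F)
      where
      ∑≡rowSum : ∀ m G → ∑< m (λ i → ⟦ G (suc i) <ᵇ G i ⟧) ≡ rowSum desRow G m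
      ∑≡rowSum zero    G = refl
      ∑≡rowSum (suc m) G = cong (desRow G m +_) (∑≡rowSum m (G ∘ suc))

    13-2≡∑ : 13-2 π ≡ ∑< n λ i → ∑< n λ j → ⟦ (suc i <ᵇ j) ∧ (F i <ᵇ F j) ∧ (F j <ᵇ F (suc i)) ⟧
    13-2≡∑ = countPairs≡∑ n λ i j → (suc i <? j) ×-dec (π ⟨ i ⟩ <? π ⟨ j ⟩) ×-dec (π ⟨ j ⟩ <? π ⟨ suc i ⟩)

    31-2≡∑ : 31-2 π ≡ ∑< n λ i → ∑< n λ j → ⟦ (suc i <ᵇ j) ∧ (F (suc i) <ᵇ F j) ∧ (F j <ᵇ F i) ⟧
    31-2≡∑ = countPairs≡∑ n λ i j → (suc i <? j) ×-dec (π ⟨ suc i ⟩ <? π ⟨ j ⟩) ×-dec (π ⟨ j ⟩ <? π ⟨ i ⟩)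

    13-2≡rowSum : 13-2 π ≡ rowSum 13-2Row F (pred n)
    13-2≡rowSum = trans 13-2≡∑ (∑-pairs≡rowSum (λ x y z → (x <ᵇ z) ∧ (z <ᵇ y)) n F)

    31-2≡rowSum : 31-2 π ≡ rowSum 31-2Row F (pred n)
    31-2≡rowSum = trans 31-2≡∑ (∑-pairs≡rowSum (λ x y z → (y <ᵇ z) ∧ (z <ᵇ x)) n F)

  -- Statistics under complement and reverse-complement

  ∑<-reverse : ∀ m h → ∑< m h ≡ ∑< m (λ i → h (m ∸ suc i))
  ∑<-reverse m h = trans (sum-permute {m} (h ∘ toℕ) reverse) (sum-cong-≗ {m} λ i → cong h (Fin.opposite-prop i))

  ∑<-drop-last : ∀ m h → h m ≡ 0 → ∑< (suc m) h ≡ ∑< m h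
  ∑<-drop-last zero    h eq = cong (_+ 0) eq
  ∑<-drop-last (suc m) h eq = cong (h 0 +_) (∑<-drop-last m (h ∘ suc) eq)

  private
    <ᵇ-⇔ : ∀ {x y x′ y′} → (x < y → x′ < y′) → (x′ < y′ → x < y) → (x <ᵇ y) ≡ (x′ <ᵇ y′)
    <ᵇ-⇔ to from = does-⇔ (mk⇔ to from) (_ <? _) (_ <? _)

    opposite-<ᵇ : ∀ {n} (i j : Fin n) → (toℕ (opposite j) <ᵇ toℕ (opposite i)) ≡ (toℕ i <ᵇ toℕ j)
    opposite-<ᵇ i j = <ᵇ-⇔ {toℕ (opposite j)} {toℕ (opposite i)} {toℕ i} {toℕ j} (opposite-cancel {i = i} {j}) (opposite-mono {i = i} {j})

  module _ {n} (π : Word n n) where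

    private
      rc⟨⟩ : ∀ x (x<n : x < n) → π ⟨ suc (n ∸ suc x) ⟩ ≡ suc (toℕ (lookup π (opposite (fromℕ< x<n))))
      rc⟨⟩ x x<n = trans (cong (λ k → π ⟨ suc k ⟩) (sym (trans (Fin.opposite-prop (fromℕ< x<n)) (cong (λ k → n ∸ suc k) (Fin.toℕ-fromℕ< x<n)))))
        (⟨⟩-toℕ π (opposite (fromℕ< x<n)))

    complement-<ᵇ : ∀ x y → x < n → y < n →
      (complement π ⟨ suc x ⟩ <ᵇ complement π ⟨ suc y ⟩) ≡ (π ⟨ suc y ⟩ <ᵇ π ⟨ suc x ⟩)
    complement-<ᵇ x y x<n y<n
      rewrite ⟨⟩-fromℕ< (complement π) x<n | ⟨⟩-fromℕ< (complement π) y<n | ⟨⟩-fromℕ< π x<n | ⟨⟩-fromℕ< π y<n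
            | lookup-complement π (fromℕ< x<n) | lookup-complement π (fromℕ< y<n)
      = opposite-<ᵇ (lookup π (fromℕ< y<n)) (lookup π (fromℕ< x<n))

    reverseComplement-<ᵇ : ∀ x y → x < n → y < n →
      (reverseComplement π ⟨ suc x ⟩ <ᵇ reverseComplement π ⟨ suc y ⟩) ≡ (π ⟨ suc (n ∸ suc y) ⟩ <ᵇ π ⟨ suc (n ∸ suc x) ⟩)
    reverseComplement-<ᵇ x y x<n y<n
      rewrite ⟨⟩-fromℕ< (reverseComplement π) x<n | ⟨⟩-fromℕ< (reverseComplement π) y<n | rc⟨⟩ x x<n | rc⟨⟩ y y<n
            | lookup-reverseComplement π (fromℕ< x<n) | lookup-reverseComplement π (fromℕ< y<n)
      = opposite-<ᵇ (lookup π (opposite (fromℕ< y<n))) (lookup π (opposite (fromℕ< x<n)))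

  Reversing : ℕ → (ℕ → ℕ) → (ℕ → ℕ) → Set
  Reversing n G F = ∀ x y → x < n → y < n → (G x <ᵇ G y) ≡ (F y <ᵇ F x)

  rowSum-reversing : ∀ {row row′ : Row} → (∀ {G F} m → Reversing (2 + m) G F → row G m ≡ row′ F m) →
    ∀ n {G F} → Reversing n G F → rowSum row G (pred n) ≡ rowSum row′ F (pred n)
  rowSum-reversing eq zero          rev = refl
  rowSum-reversing eq (suc zero)    rev = refl
  rowSum-reversing eq (suc (suc m)) rev = cong₂ _+_ (eq m rev)
    (rowSum-reversing eq (suc m) λ x y x<n y<n → rev (suc x) (suc y) (s≤s x<n) (s≤s y<n))

  -- Given directly as a sum of rows, since it arises only as the image of `des` under the
  -- complement.
  asc : ∀ {n} → Word n n → ℕ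
  asc {n} π = rowSum ascRow (λ i → π ⟨ suc i ⟩) (pred n)

  private
    0<2+ : ∀ {m} → 0 < 2 + m
    0<2+ = s≤s z≤n
    1<2+ : ∀ {m} → 1 < 2 + m
    1<2+ = s≤s (s≤s z≤n)

  module _ {n} (π : Word n n) where

    asc-complement : asc (complement π) ≡ des π
    asc-complement = trans
      (rowSum-reversing (λ m rev → cong ⟦_⟧ (rev 0 1 0<2+ 1<2+)) n (complement-<ᵇ π))
      (sym (des≡rowSum π))

    13-2-complement : 13-2 (complement π) ≡ 31-2 π
    13-2-complement = trans (13-2≡rowSum (complement π)) (trans
      (rowSum-reversing (λ {G} {F} m rev → ∑<-cong m λ j j<m → cong ⟦_⟧ (trans
         (cong₂ _∧_ (rev 0 (2 + j) 0<2+ (s≤s (s≤s j<m))) (rev (2 + j) 1 (s≤s (s≤s j<m)) 1<2+))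
         (∧-comm (F (2 + j) <ᵇ F 0) (F 1 <ᵇ F (2 + j)))))
        n (complement-<ᵇ π))
      (sym (31-2≡rowSum π)))

    31-2-complement : 31-2 (complement π) ≡ 13-2 π
    31-2-complement = trans (31-2≡rowSum (complement π)) (trans
      (rowSum-reversing (λ {G} {F} m rev → ∑<-cong m λ j j<m → cong ⟦_⟧ (trans
         (cong₂ _∧_ (rev 1 (2 + j) 1<2+ (s≤s (s≤s j<m))) (rev (2 + j) 0 (s≤s (s≤s j<m)) 0<2+))
         (∧-comm (F (2 + j) <ᵇ F 1) (F 0 <ᵇ F (2 + j)))))
        n (complement-<ᵇ π))
      (sym (13-2≡rowSum π)))

  private
    suc-∸-suc : ∀ {i m} → i < m → suc (m ∸ suc i) ≡ m ∸ i
    suc-∸-suc {i} {m} i<m = sym (+-∸-assoc 1 i<m)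

    ∸-<ᵇ : ∀ {m} i j → j ≤ m → i < m → (m ∸ j <ᵇ m ∸ suc i) ≡ (suc i <ᵇ j)
    ∸-<ᵇ {m} i j j≤m i<m = <ᵇ-⇔ (∸-cancelˡ-< {m} {j} {suc i}) (λ lt → ∸-monoʳ-< lt j≤m)
      where
      ∸-cancelˡ-< : ∀ {m j k} → m ∸ j < m ∸ k → k < j
      ∸-cancelˡ-< {m} {j} {k} lt = ≰⇒> λ j≤k → <⇒≱ lt (∸-monoʳ-≤ m j≤k)

    -- Reversal sends position j to m - j, but the step from i to i + 1 to the step that starts at m
    -- - (i + 1). So the outer sum is reversed over m steps and the inner one over m + 1 positions;
    -- the outer term at `m` vanishes on both sides.
    ∑-pairs-reverse : ∀ m (g h : ℕ → ℕ → Bool) → (∀ i j → i < m → j ≤ m → g (m ∸ suc i) (m ∸ j) ≡ h i j) →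
      ∑< (suc m) (λ i → ∑< (suc m) (λ j → ⟦ (j <ᵇ i) ∧ (i <ᵇ m) ∧ g i j ⟧)) ≡
      ∑< (suc m) (λ i → ∑< (suc m) (λ j → ⟦ (suc i <ᵇ j) ∧ h i j ⟧))
    ∑-pairs-reverse m g h eq = begin
      ∑< (suc m) A        ≡⟨ ∑<-drop-last m A (∑<-zero (suc m) (a m) λ j _ → last-A j) ⟩
      ∑< m A              ≡⟨ ∑<-reverse m A ⟩
      ∑< m (λ i → A (m ∸ suc i))
                          ≡⟨ ∑<-cong m (λ i i<m → trans (∑<-reverse (suc m) (a (m ∸ suc i))) (∑<-cong (suc m) λ j j≤m → pointwise i j i<m (s≤s⁻¹ j≤m))) ⟩
      ∑< m B              ≡⟨ ∑<-drop-last m B (∑<-zero (suc m) (b m) λ j j≤m → last-B j (s≤s⁻¹ j≤m)) ⟨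
      ∑< (suc m) B        ∎
      where
      open ≡-Reasoning
      a b : ℕ → ℕ → ℕ
      a i j = ⟦ (j <ᵇ i) ∧ (i <ᵇ m) ∧ g i j ⟧
      b i j = ⟦ (suc i <ᵇ j) ∧ h i j ⟧
      A B : ℕ → ℕ
      A i = ∑< (suc m) (a i)
      B i = ∑< (suc m) (b i)
      last-A : ∀ j → a m j ≡ 0
      last-A j rewrite ≤⇒<ᵇ≡false (≤-refl {m}) = cong ⟦_⟧ (∧-zeroʳ (j <ᵇ m))
      last-B : ∀ j → j ≤ m → b m j ≡ 0
      last-B j j≤m rewrite ≤⇒<ᵇ≡false (m≤n⇒m≤1+n j≤m) = refl
      pointwise : ∀ i j → i < m → j ≤ m → a (m ∸ suc i) (m ∸ j) ≡ b i j
      pointwise i j i<m j≤m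
        rewrite ∸-<ᵇ i j j≤m i<m | <⇒<ᵇ≡true (≤-trans (≤-reflexive (suc-∸-suc i<m)) (m∸n≤m m i)) | eq i j i<m j≤m = refl

  module _ {m} (π : Word (suc m) (suc m)) where

    private
      ρ = reverseComplement π

      F G : ℕ → ℕ
      F i = π ⟨ suc i ⟩
      G i = ρ ⟨ suc i ⟩

      module _ i j (i<m : i < m) (j≤m : j ≤ m) where

        i≤m = m≤n⇒m≤1+n i<m

        Gi<Gj : (G i <ᵇ G j) ≡ (F (m ∸ j) <ᵇ F (suc (m ∸ suc i)))
        Gi<Gj = trans (reverseComplement-<ᵇ π i j i≤m (s≤s j≤m)) (cong (λ k → F (m ∸ j) <ᵇ F k) (sym (suc-∸-suc i<m)))

        Gj<Gi : (G j <ᵇ G i) ≡ (F (suc (m ∸ suc i)) <ᵇ F (m ∸ j))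
        Gj<Gi = trans (reverseComplement-<ᵇ π j i (s≤s j≤m) i≤m) (cong (λ k → F k <ᵇ F (m ∸ j)) (sym (suc-∸-suc i<m)))

        Gj<Gsi : (G j <ᵇ G (suc i)) ≡ (F (m ∸ suc i) <ᵇ F (m ∸ j))
        Gj<Gsi = reverseComplement-<ᵇ π j (suc i) (s≤s j≤m) (s≤s i<m)

        Gsi<Gj : (G (suc i) <ᵇ G j) ≡ (F (m ∸ j) <ᵇ F (m ∸ suc i))
        Gsi<Gj = reverseComplement-<ᵇ π (suc i) j (s≤s i<m) (s≤s j≤m)

    des-reverseComplement⁺ : des ρ ≡ des π
    des-reverseComplement⁺ = begin
      des ρ                                        ≡⟨ count≡∑ m (λ i → ρ ⟨ suc i ⟩ <? ρ ⟨ i ⟩) ⟩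
      ∑< m (λ i → ⟦ G (suc i) <ᵇ G i ⟧)            ≡⟨ ∑<-cong m (λ i i<m → cong ⟦_⟧ (step i i<m)) ⟩
      ∑< m (λ i → d (m ∸ suc i))                   ≡⟨ ∑<-reverse m d ⟨
      ∑< m d                                       ≡⟨ count≡∑ m (λ i → π ⟨ suc i ⟩ <? π ⟨ i ⟩) ⟨
      des π                                        ∎
      where
      open ≡-Reasoning
      d : ℕ → ℕ
      d i = ⟦ F (suc i) <ᵇ F i ⟧
      step : ∀ i → i < m → (G (suc i) <ᵇ G i) ≡ (F (suc (m ∸ suc i)) <ᵇ F (m ∸ suc i))
      step i i<m = Gj<Gi i (suc i) i<m i<m

    13-2-reverseComplement⁺ : 13-2 ρ ≡ 2-13 π
    13-2-reverseComplement⁺ = begin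
      13-2 ρ   ≡⟨ 13-2≡∑ ρ ⟩
      _        ≡⟨ ∑-pairs-reverse m (λ i j → (F i <ᵇ F j) ∧ (F j <ᵇ F (suc i))) (λ i j → (G i <ᵇ G j) ∧ (G j <ᵇ G (suc i)))
                    (λ i j i<m j≤m → sym (trans (cong₂ _∧_ (Gi<Gj i j i<m j≤m) (Gj<Gsi i j i<m j≤m)) (∧-comm _ (F (m ∸ suc i) <ᵇ F (m ∸ j))))) ⟨
      _        ≡⟨ countPairs≡∑ (suc m) (λ i j → (j <? i) ×-dec (i <? suc m) ×-dec (π ⟨ i ⟩ <? π ⟨ j ⟩) ×-dec (π ⟨ j ⟩ <? π ⟨ suc i ⟩)) ⟨
      2-13 π   ∎
      where open ≡-Reasoning

    31-2-reverseComplement⁺ : 31-2 ρ ≡ 2-31 π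
    31-2-reverseComplement⁺ = begin
      31-2 ρ   ≡⟨ 31-2≡∑ ρ ⟩
      _        ≡⟨ ∑-pairs-reverse m (λ i j → (F (suc i) <ᵇ F j) ∧ (F j <ᵇ F i)) (λ i j → (G (suc i) <ᵇ G j) ∧ (G j <ᵇ G i))
                    (λ i j i<m j≤m → sym (trans (cong₂ _∧_ (Gsi<Gj i j i<m j≤m) (Gj<Gi i j i<m j≤m)) (∧-comm (F (m ∸ j) <ᵇ F (m ∸ suc i)) _))) ⟨
      _        ≡⟨ countPairs≡∑ (suc m) (λ i j → (j <? i) ×-dec (i <? suc m) ×-dec (π ⟨ suc i ⟩ <? π ⟨ j ⟩) ×-dec (π ⟨ j ⟩ <? π ⟨ i ⟩)) ⟨
      2-31 π   ∎
      where open ≡-Reasoning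

  des-reverseComplement : ∀ {n} (π : Word n n) → des (reverseComplement π) ≡ des π
  des-reverseComplement {zero}  [] = refl
  des-reverseComplement {suc _} π  = des-reverseComplement⁺ π

  13-2-reverseComplement : ∀ {n} (π : Word n n) → 13-2 (reverseComplement π) ≡ 2-13 π
  13-2-reverseComplement {zero}  [] = refl
  13-2-reverseComplement {suc _} π  = 13-2-reverseComplement⁺ π

  31-2-reverseComplement : ∀ {n} (π : Word n n) → 31-2 (reverseComplement π) ≡ 2-31 π
  31-2-reverseComplement {zero}  [] = refl
  31-2-reverseComplement {suc _} π  = 31-2-reverseComplement⁺ π

  -- In an admissible pair the second alternative of the definition, and the failure of
  -- the remaining vincular inequality, would each produce the forbidden pattern.
  adi*≡13-2 : ∀ {n} (π : Word n n) → IsPermutation π → Avoids p231 π → adi* π ≡ 13-2 π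
  adi*≡13-2 {zero}  [] perm av = refl
  adi*≡13-2 {suc m} π  perm av = begin
    adi* π          ≡⟨ countPairs≡∑ (suc m) adi*? ⟩
    -- The larger entry of the inversion is the end of the ascent, so row `suc i` of `A` meets row
    -- `i` of `B`. Row 0 of `A` vanishes because π(0) = n + 1 exceeds the first letter and avoidance
    -- excludes a higher letter in between; row `m` of `B` vanishes because no position follows.
    ∑< (suc m) A    ≡⟨ cong (_+ ∑< m (A ∘ suc)) (∑<-zero (suc m) (a 0) first) ⟩
    ∑< m (A ∘ suc)  ≡⟨ ∑<-cong m (λ i i<m → ∑<-cong (suc m) λ j j<n → cong ⟦_⟧ (does-⇔ (equivalent i j i<m j<n) (adi*? (2 + i) (suc j)) (13-2? i j))) ⟩
    ∑< m B          ≡⟨ ∑<-drop-last m B (∑<-zero (suc m) (b m) last) ⟨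
    ∑< (suc m) B    ≡⟨ 13-2≡∑ π ⟨
    13-2 π          ∎
    where
    open ≡-Reasoning
    F : ℕ → ℕ
    F i = π ⟨ suc i ⟩
    Adi* : ℕ → ℕ → Set
    Adi* i j = i < j × π ⟨ j ⟩ < π ⟨ i ⟩ × (π ⟨ pred i ⟩ < π ⟨ i ⟩ ⊎ ∃ λ l → l < j × i < l × π ⟨ i ⟩ < π ⟨ l ⟩)
    adi*? : ∀ i j → Dec (Adi* i j)
    adi*? i j = (i <? j) ×-dec (π ⟨ j ⟩ <? π ⟨ i ⟩) ×-dec
      ((π ⟨ pred i ⟩ <? π ⟨ i ⟩) ⊎-dec anyUpTo? (λ l → (i <? l) ×-dec (π ⟨ i ⟩ <? π ⟨ l ⟩)) j)
    13-2? : ∀ i j → Dec (suc i < j × F i < F j × F j < F (suc i))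
    13-2? i j = (suc i <? j) ×-dec (F i <? F j) ×-dec (F j <? F (suc i))
    a b : ℕ → ℕ → ℕ
    a i j = ⟦ does (adi*? (suc i) (suc j)) ⟧
    b i j = ⟦ does (13-2? i j) ⟧
    A B : ℕ → ℕ
    A i = ∑< (suc m) (a i)
    B i = ∑< (suc m) (b i)
    no-higher : ∀ {i j} → j < suc m → F j < F i → ¬ (∃ λ l → l < suc j × suc i < l × π ⟨ suc i ⟩ < π ⟨ l ⟩)
    no-higher {i} {j} j<n Fj<Fi (suc l , s≤s l<j , s≤s i<l , Fi<Fl) = avoids-231 {π = π} av i l j i<l l<j j<n Fj<Fi Fi<Fl
    first : ∀ j → j < suc m → a 0 j ≡ 0
    first j j<n = cong ⟦_⟧ (dec-false (adi*? 1 (suc j)) λ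
      { (_ , _ , inj₁ n<F₀)   → <⇒≱ n<F₀ (m≤n⇒m≤1+n (proj₂ (⟨⟩-bounds π 0 (s≤s z≤n))))
      ; (_ , lt , inj₂ higher) → no-higher j<n lt higher })
    last : ∀ j → j < suc m → b m j ≡ 0
    last j j<n = cong ⟦_⟧ (dec-false (13-2? m j) λ (lt , _) → <-asym lt j<n)
    equivalent : ∀ i j → i < m → j < suc m → Adi* (2 + i) (suc j) ⇔ (suc i < j × F i < F j × F j < F (suc i))
    equivalent i j i<m j<n = mk⇔ to (λ (si<j , lo , hi) → s≤s si<j , hi , inj₁ (<-trans lo hi))
      where
      to : Adi* (2 + i) (suc j) → suc i < j × F i < F j × F j < F (suc i)
      to (_ , lt , inj₂ higher) = ⊥-elim (no-higher j<n lt higher)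
      to (s≤s si<j , lt , inj₁ step) with <-cmp (F i) (F j)
      ... | tri< Fi<Fj _ _ = si<j , Fi<Fj , lt
      ... | tri≈ _ eq _    = contradiction eq (⟨⟩-injective π perm i j (<-trans (n<1+n i) si<j) j<n)
      ... | tri> _ _ Fj<Fi = ⊥-elim (avoids-231 {π = π} av i (suc i) j (n<1+n i) si<j j<n Fj<Fi step)

  adi≡2-13 : ∀ {n} (π : Word n n) → IsPermutation π → Avoids p312 π → adi π ≡ 2-13 π
  adi≡2-13 {n} π perm av = begin
    adi π                                        ≡⟨ countPairs≡∑ n adi? ⟩
    -- The smaller entry of the inversion starts the ascent. `2-13` indexes that step first and
    -- `adi` indexes it second, hence the exchange of sums.
    ∑< n (λ i → ∑< n (λ j → a i j))              ≡⟨ ∑-comm {n} {n} (λ i j → a (toℕ i) (toℕ j)) ⟩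
    ∑< n (λ j → ∑< n (λ i → a i j))              ≡⟨ ∑<-cong n (λ j j<n → ∑<-cong n λ i i<n →
                                                      cong ⟦_⟧ (does-⇔ (equivalent i j i<n j<n) (adi? (suc i) (suc j)) (2-13? (suc j) (suc i)))) ⟩
    ∑< n (λ j → ∑< n (λ i → b j i))              ≡⟨ countPairs≡∑ n 2-13? ⟨
    2-13 π                                       ∎
    where
    open ≡-Reasoning
    F : ℕ → ℕ
    F i = π ⟨ suc i ⟩
    Adi 2-13′ : ℕ → ℕ → Set
    Adi i j = i < j × π ⟨ j ⟩ < π ⟨ i ⟩ × (π ⟨ j ⟩ < π ⟨ suc j ⟩ ⊎ ∃ λ l → l < j × i < l × π ⟨ l ⟩ < π ⟨ j ⟩)
    2-13′ i j = j < i × i < n × π ⟨ i ⟩ < π ⟨ j ⟩ × π ⟨ j ⟩ < π ⟨ suc i ⟩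
    adi? : ∀ i j → Dec (Adi i j)
    adi? i j = (i <? j) ×-dec (π ⟨ j ⟩ <? π ⟨ i ⟩) ×-dec
      ((π ⟨ j ⟩ <? π ⟨ suc j ⟩) ⊎-dec anyUpTo? (λ l → (i <? l) ×-dec (π ⟨ l ⟩ <? π ⟨ j ⟩)) j)
    2-13? : ∀ i j → Dec (2-13′ i j)
    2-13? i j = (j <? i) ×-dec (i <? n) ×-dec (π ⟨ i ⟩ <? π ⟨ j ⟩) ×-dec (π ⟨ j ⟩ <? π ⟨ suc i ⟩)
    a b : ℕ → ℕ → ℕ
    a i j = ⟦ does (adi? (suc i) (suc j)) ⟧
    b j i = ⟦ does (2-13? (suc j) (suc i)) ⟧
    equivalent : ∀ i j → i < n → j < n → Adi (suc i) (suc j) ⇔ 2-13′ (suc j) (suc i)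
    equivalent i j i<n j<n = mk⇔ to (λ (i<j , _ , lo , hi) → i<j , lo , inj₁ (<-trans lo hi))
      where
      to : Adi (suc i) (suc j) → 2-13′ (suc j) (suc i)
      to (_ , lt , inj₂ (suc l , s≤s l<j , s≤s i<l , Fl<Fj)) = ⊥-elim (avoids-312 {π = π} av i l j i<l l<j j<n Fl<Fj lt)
      to (s≤s i<j , lt , inj₁ step) with <-≤-connex (suc j) n
      -- At the last position the convention π(n + 1) = 0 excludes an ascent, which supplies the
      -- bound i < n in `2-13`.
      ... | inj₂ n≤sj = contradiction (≤-trans step (≤-reflexive (beyond (≤⇒≯ n≤sj)))) λ ()
        where
        beyond : ¬ suc j < n → π ⟨ 2 + j ⟩ ≡ 0
        beyond ≮n with suc j <? n
        ... | yes <n = contradiction <n ≮n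
        ... | no _   = refl
      ... | inj₁ sj<n with <-cmp (F i) (F (suc j))
      ...   | tri< Fi<Fsj _ _ = s≤s i<j , sj<n , lt , Fi<Fsj
      ...   | tri≈ _ eq _     = contradiction eq (⟨⟩-injective π perm i (suc j) (m<n⇒m<1+n i<j) sj<n)
      ...   | tri> _ _ Fsj<Fi = ⊥-elim (avoids-312 {π = π} av i j (suc j) i<j (n<1+n j) sj<n step Fsj<Fi)

-- The ten enumerations

module AvoiderSums {a ℓ} (R : CommutativeRing a ℓ) (t q : CommutativeRing.Carrier R) (n : ℕ) where

  open CommutativeRing R hiding (zero; refl)
  open import Algebra.Properties.Semiring.Exp semiring using (_^_)
  open QTCatalan R t q
  open ListSums R
  open TreeSums R t q using (rootWeight)
  open CatalanTrees R t q

  Enumerated : ∀ {k} → Word k k → (d s : Word n n → ℕ) → Set ℓ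
  Enumerated τ d s = C n ≈ ∑ (𝔖 n τ) (λ π → t ^ d π * q ^ s π)

  private
    monomial-cong : ∀ {i i′ j j′} → i ≡ i′ → j ≡ j′ → t ^ i * q ^ j ≈ t ^ i′ * q ^ j′
    monomial-cong i≡i′ j≡j′ = reflexive (cong₂ (λ i j → t ^ i * q ^ j) i≡i′ j≡j′)

  enumerated-231 : ∀ {dRow sRow dᶜ sᶜ} → TreeRow dRow dᶜ → TreeRow sRow sᶜ →
    (d s : Word n n → ℕ) →
    (∀ π → d π ≡ rowSum dRow (λ i → π ⟨ suc i ⟩) (pred n)) → (∀ π → s π ≡ rowSum sRow (λ i → π ⟨ suc i ⟩) (pred n)) →
    ∑ (trees n n) (rootWeight dᶜ sᶜ) ≈ C n → Enumerated p231 d s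
  enumerated-231 {dRow} {sRow} {dᶜ} {sᶜ} dTree sTree d s d≡ s≡ trees-sum = sym
    (trans (∑-↭ _ (𝔖-231-trees n))
    (trans (∑-map (toWord n) (λ π → t ^ d π * q ^ s π) (trees n n))
    (trans (∑-cong (trees n n) λ T∈ → monomial-cong
             (≡.trans (d≡ _) (evaluate dTree T∈)) (≡.trans (s≡ _) (evaluate sTree T∈)))
           trees-sum)))
    where
    evaluate : ∀ {row e} → TreeRow row e → ∀ {T} → T ∈ trees n n →
      rowSum row (λ i → toWord n T ⟨ suc i ⟩) (pred n) ≡ rootStat e T
    evaluate {row} {e} treeRow {T} T∈ = subst (λ m → rowSum row (λ i → toWord n T ⟨ suc i ⟩) (pred m) ≡ rootStat e T)
      (∈-trees⁻ n n T∈) (rowSum-root treeRow T (toWord n T ⟨_⟩) (toWord-Rep T (∈-trees⁻ n n T∈)))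

  enumerated-symmetric : ∀ {φ : ∀ {k} → Word k k → Word k k} → Symmetry φ → ∀ {k} (τ : Word k k) d s {d′ s′} →
    (∀ π → d (φ π) ≡ d′ π) → (∀ π → s (φ π) ≡ s′ π) → Enumerated (φ τ) d s → Enumerated τ d′ s′
  enumerated-symmetric {φ} sym-φ τ d s d≡ s≡ enum = trans enum
    (trans (∑-↭ _ (Symmetry.𝔖-symmetric sym-φ n τ))
    (trans (∑-map φ (λ π → t ^ d π * q ^ s π) (𝔖 n τ))
           (∑-cong (𝔖 n τ) λ {π} _ → monomial-cong (d≡ π) (s≡ π))))

  enumerated-cong : ∀ {k} (τ : Word k k) d s {s′} → (∀ π → IsPermutation π → Avoids τ π → s′ π ≡ s π) →
    Enumerated τ d s → Enumerated τ d s′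
  enumerated-cong τ d s s′≡s enum = trans enum (∑-cong (𝔖 n τ) λ {π} π∈ →
    let perm , av = Equivalence.to (∈-𝔖 τ π) π∈ in monomial-cong {d π} refl (≡.sym (s′≡s π perm av)))

  231-13-2 : Enumerated p231 des 13-2
  231-13-2 = enumerated-231 desRow-tree 13-2Row-tree des 13-2 des≡rowSum 13-2≡rowSum (des-13-2-sum n)

  231-31-2 : Enumerated p231 des 31-2
  231-31-2 = enumerated-231 desRow-tree 31-2Row-tree des 31-2 des≡rowSum 31-2≡rowSum (des-31-2-sum n)

  213-31-2 : Enumerated p213 des 31-2
  -- The pattern is concrete: `complement p213` evaluates to `p231`, so the enumeration below has
  -- the required type.
  213-31-2 = enumerated-symmetric complement-symmetry p213 asc 13-2 asc-complement 13-2-complement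
    (enumerated-231 ascRow-tree 13-2Row-tree asc 13-2 (λ _ → refl) 13-2≡rowSum (asc-13-2-sum n))

  213-13-2 : Enumerated p213 des 13-2
  213-13-2 = enumerated-symmetric complement-symmetry p213 asc 31-2 asc-complement 31-2-complement
    (enumerated-231 ascRow-tree 31-2Row-tree asc 31-2 (λ _ → refl) 31-2≡rowSum (asc-31-2-sum n))

  312-2-13 : Enumerated p312 des 2-13
  312-2-13 = enumerated-symmetric reverseComplement-symmetry p312 des 13-2 des-reverseComplement 13-2-reverseComplement 231-13-2

  312-2-31 : Enumerated p312 des 2-31
  312-2-31 = enumerated-symmetric reverseComplement-symmetry p312 des 31-2 des-reverseComplement 31-2-reverseComplement 231-31-2

  132-2-31 : Enumerated p132 des 2-31
  132-2-31 = enumerated-symmetric reverseComplement-symmetry p132 des 31-2 des-reverseComplement 31-2-reverseComplement 213-31-2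

  132-2-13 : Enumerated p132 des 2-13
  132-2-13 = enumerated-symmetric reverseComplement-symmetry p132 des 13-2 des-reverseComplement 13-2-reverseComplement 213-13-2

theorem1p1 : ∀ {a ℓ} (R : CommutativeRing a ℓ) (t q : CommutativeRing.Carrier R) (n : ℕ) →
    let open CommutativeRing R using (_≈_)
        open QTCatalan R t q
    in All (λ (τ , stat) → C n ≈ Σ𝔖 n τ stat) (pairs n)
theorem1p1 R t q n =
  231-13-2 ∷
  enumerated-cong p231 des 13-2 adi*≡13-2 231-13-2 ∷
  312-2-13 ∷
  enumerated-cong p312 des 2-13 adi≡2-13 312-2-13 ∷
  213-31-2 ∷
  132-2-31 ∷
  231-31-2 ∷
  312-2-31 ∷
  213-13-2 ∷
  132-2-13 ∷ []
  where open AvoiderSums R t q n
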